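{- Let $G^\sigma$ be a connected oriented unicyclic graph of even order $n$ with cycle $C_k^\sigma$. Then $S(G^\sigma)$ is nonsingular if and only if either $G^\sigma\in\mathscr{U}_1$ and $G^\sigma$ has a perfect matching, or $G^\sigma\in\mathscr{U}_2$, $C_k^\sigma$ is oddly-oriented and $G^\sigma-C_k^\sigma$ has a perfect matching.
   Context: An oriented graph $G^\sigma$ is a simple graph with an orientation of each edge. Its skew-adjacency matrix $S(G^\sigma)=(s_{ij})$ has $s_{ij}=1$ if there is an arc from $v_i$ to $v_j$, $s_{ij}=-1$ if there is an arc from $v_j$ to $v_i$, and $0$ otherwise. For an even cycle $u_1\cdots u_ku_1$, its sign is the sign of $\prod_{i=1}^k s_{u_iu_{i+1}}$ ($u_{k+1}=u_1$); it is oddly-oriented if this sign is negative. A $\delta$-transformation deletes a pendant vertex (degree one) together with its unique neighbor and all incident edges. With $k$ the girth, $\mathscr{U}_1$ is the set of oriented unicyclic graphs of order $n$ with girth $k$ that can be transformed into a graph without edges by finitely many $\delta$-transformations; $\mathscr{U}_2$ is the set of those that can be transformed into $C_k^\sigma$ or the disjoint union of $C_k^\sigma$ with isolated vertices by finitely many $\delta$-transformations. $G^\sigma-C_k^\sigma$ is obtained by deleting the cycle's vertices and incident edges. -}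

module Defs where

open import Level using (0ℓ; suc)
open import Data.Nat as ℕ using (ℕ; _≤_)
open import Data.Nat.Divisibility using (_∣_)
open import Data.Nat.DivMod using (_mod_)
open import Data.Fin using (Fin; toℕ)
open import Data.Fin.Properties using (_≟_; any?)
open import Data.Fin.Subset using (Subset; _∈_; _⊆_; _∩_; _-_; ⊤; ∣_∣)
open import Data.Product using (Σ; ∃!; ∃-syntax; _×_)
open import Data.Rational using (ℚ; 0ℚ; 1ℚ; -_; _*_; _<_; +-0-rawMonoid; *-1-rawMonoid)
open import Data.Sum using (_⊎_)
open import Data.Vec using (tabulate)
open import Function.Bundles using (_⇔_)
open import Function.Definitions using (Injective)
open import Relation.Binary using (Rel; Decidable; Symmetric; Asymmetric)
open import Relation.Binary.Construct.Closure.ReflexiveTransitive using (Star)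
open import Relation.Binary.PropositionalEquality using (_≡_)
open import Relation.Nullary using (¬_; yes; no; does)
open import Relation.Nullary.Decidable using (_⊎-dec_)

open import Algebra.Definitions.RawMonoid +-0-rawMonoid using (sum)
open import Algebra.Definitions.RawMonoid *-1-rawMonoid using () renaming (sum to product)

------------------------------------------------------------------------
-- Square rational matrices

Matrix : ℕ → Set
Matrix n = Fin n → Fin n → ℚ

_·_ : ∀ {n} → Matrix n → Matrix n → Matrix n
(A · B) i j = sum (λ k → A i k * B k j)

𝟙 : ∀ {n} → Matrix n
𝟙 i j with i ≟ j
... | yes _ = 1ℚ
... | no  _ = 0ℚ

Nonsingular : ∀ {n} → Matrix n → Set
Nonsingular {n} A =
  Σ (Matrix n) λ B → (∀ i j → (A · B) i j ≡ 𝟙 i j) × (∀ i j → (B · A) i j ≡ 𝟙 i j)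

------------------------------------------------------------------------
-- Oriented graphs on the vertex set Fin n

-- Asymmetry of the arc relation excludes loops and pairs of opposite arcs,
-- so the underlying graph is simple and each of its edges has exactly one
-- direction.
record OrientedGraph (n : ℕ) : Set (suc 0ℓ) where
  infix 4 _⟶_ _⟶?_ _~_ _~?_
  field
    _⟶_  : Rel (Fin n) 0ℓ
    _⟶?_ : Decidable _⟶_
    asym : Asymmetric _⟶_

  _~_ : Rel (Fin n) 0ℓ
  u ~ v = u ⟶ v ⊎ v ⟶ u

  _~?_ : Decidable _~_
  u ~? v = (u ⟶? v) ⊎-dec (v ⟶? u)

  skewAdjacency : Matrix n
  skewAdjacency u v with u ⟶? v | v ⟶? u
  ... | yes _ | _     = 1ℚ
  ... | no _  | yes _ = - 1ℚ
  ... | no _  | no _  = 0ℚ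

  Connected : Set
  Connected = ∀ u v → Star _~_ u v

-- Deleting vertices together with their incident edges gives an induced
-- subgraph, so the graphs obtained from G by deletions are represented by
-- their vertex sets W : Subset n, standing for G[W].
module _ {n} (G : OrientedGraph n) where
  open OrientedGraph G

  neighbours : Subset n → Fin n → Subset n
  neighbours W v = W ∩ tabulate (λ u → does (v ~? u))

  degree : Subset n → Fin n → ℕ
  degree W v = ∣ neighbours W v ∣

  Edgeless : Subset n → Set
  Edgeless W = ∀ {u v} → u ∈ W → v ∈ W → ¬ (u ~ v)

  record δ-Transformation (W W′ : Subset n) : Set where
    field
      pendant    : Fin n
      neighbour  : Fin n
      pendant∈W  : pendant ∈ W
      degree≡1   : degree W pendant ≡ 1
      neighbour∈ : neighbour ∈ neighbours W pendant
      result     : W′ ≡ W - pendant - neighbour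

  -- G can be transformed into G[W] by finitely many (possibly zero)
  -- δ-transformations.
  TransformsTo : Subset n → Set
  TransformsTo = Star δ-Transformation ⊤

  -- M is the set of matching edges, given as a symmetric relation.
  record PerfectMatching (W : Subset n) : Set (suc 0ℓ) where
    field
      M       : Rel (Fin n) 0ℓ
      M-sym   : Symmetric M
      M-edges : ∀ {u v} → M u v → u ∈ W × v ∈ W × u ~ v
      covers  : ∀ {u} → u ∈ W → ∃! _≡_ (M u)

  -- A cycle u₀ u₁ ⋯ u₍ₖ₋₁₎ u₀ with k = 3 + extra, so that k ≥ 3.
  record Cycle : Set where
    field
      extra : ℕ

    length : ℕ
    length = 3 ℕ.+ extra

    next : Fin length → Fin length
    next i = ℕ.suc (toℕ i) mod length

    field
      vertex    : Fin length → Fin n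
      injective : Injective _≡_ _≡_ vertex
      adjacent  : ∀ i → vertex i ~ vertex (next i)

    vertexSet : Subset n
    vertexSet = tabulate (λ v → does (any? (λ i → vertex i ≟ v)))

    Edge : Rel (Fin n) 0ℓ
    Edge u v = ∃[ i ] ((u ≡ vertex i × v ≡ vertex (next i)) ⊎
                       (v ≡ vertex i × u ≡ vertex (next i)))

    OddlyOriented : Set
    OddlyOriented =
      2 ∣ length × product (λ i → skewAdjacency (vertex i) (vertex (next i))) < 0ℚ

  open Cycle

  -- A Cycle carries a starting point and a direction of traversal; two of
  -- them are the same cycle of G when they have the same edges.
  SameCycle : Rel Cycle 0ℓ
  SameCycle C D = ∀ u v → Edge C u v ⇔ Edge D u v

  Unicyclic : Set
  Unicyclic = Σ Cycle λ C → ∀ D → SameCycle C D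

  Girth : ℕ → Set
  Girth k = (Σ Cycle λ C → length C ≡ k) × (∀ C → k ≤ length C)

  -- G[W] is the disjoint union of C with zero or more isolated vertices.
  CycleWithIsolated : Cycle → Subset n → Set
  CycleWithIsolated C W =
    vertexSet C ⊆ W × (∀ {u v} → u ∈ W → v ∈ W → u ~ v → Edge C u v)

  𝒰₁ : ℕ → Set
  𝒰₁ k = Unicyclic × Girth k × ∃[ W ] (TransformsTo W × Edgeless W)

  𝒰₂ : ℕ → Set
  𝒰₂ k = Unicyclic × Girth k ×
         Σ Cycle λ C → ∃[ W ] (TransformsTo W × CycleWithIsolated C W)

{-# OPTIONS --safe #-}

-- Call S[W] solvable if S[W] x = b has a solution for every b. A δ-transformation
-- removing a pendant vertex p and its neighbour q preserves solvability in both
-- directions: row p determines x q, and row q determines x p; it likewise preserves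
-- perfect matchings. When no pendant vertex is left, the remaining graph is edgeless
-- or consists of the cycle and isolated vertices, and an isolated vertex gives a zero
-- row. On the cycle, with σᵢ the signs of consecutive arcs and P their product, the
-- vector with entries ∏_{j<i} σⱼ lies in the kernel if P = 1, the one with entries
-- ∏_{j<i} (− σⱼ) if P = − 1 and the length is odd, and if P = − 1 and the length is
-- even the system can be solved explicitly.
module Submission where

open import Defs
open import Algebra.Bundles using (CommutativeRing)
open import Data.Empty using (⊥-elim)
open import Data.Fin using (Fin; zero; suc; toℕ; fromℕ)
open import Data.Fin.Properties using (_≟_; any?; toℕ-fromℕ<; toℕ-injective; toℕ<n; toℕ-fromℕ; injective⇒≤)
open import Data.Fin.Subset using (Subset; inside; _∈_; _∉_; _⊆_; _∩_; _─_; ∁; ⊤; ⊥; ∣_∣; ⁅_⁆)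
  renaming (_-_ to infixl 5 _∖_)
open import Data.Fin.Subset.Properties
open import Data.Nat as ℕ using (ℕ; zero; suc; s≤s)
open import Data.Nat.Divisibility using (_∣_; divides; ∣m∣n⇒∣m+n; ∣m+n∣m⇒∣n; ∣⇒≤; n∣m*n; ∣-refl)
open import Data.Nat.DivMod
  using (_%_; _/_; _mod_; m≡m%n+[m/n]*n; [m+kn]%n≡m%n; [m+n]%n≡m%n; m<n⇒m%n≡m; n%n≡0; %-distribˡ-+; m%n<n)
import Data.Nat.Properties as ℕ
open import Data.Product using (Σ; ∃; ∃₂; _×_; _,_; proj₁; proj₂)
open import Data.Rational using (ℚ; 0ℚ; 1ℚ; ½; _+_; _*_; -_; _<_)
open import Data.Rational.Properties
  using (+-*-commutativeRing; *-1-monoid; +-identityˡ; +-identityʳ; *-zeroˡ; *-zeroʳ; *-identityˡ; *-identityʳ;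
         *-comm; 1≢0; _<?_)
open import Data.Rational.Solver using (module +-*-Solver)
open import Data.Sum using (_⊎_; inj₁; inj₂; swap)
open import Data.Vec using (Vec; []; _∷_; here; there; lookup; tabulate)
open import Data.Vec.Membership.Propositional using () renaming (_∈_ to _∈ᵛ_; _∉_ to _∉ᵛ_)
open import Data.Vec.Membership.Propositional.Properties using (∈-lookup)
open import Data.Vec.Properties using (lookup∘tabulate; lookup⇒[]=; []=⇒lookup)
open import Data.Vec.Relation.Unary.Any using (here; there)
open import Function using (_∘_)
open import Function.Bundles using (_⇔_; mk⇔; Equivalence)
open import Function.Properties.Equivalence using () renaming (sym to ⇔-sym; trans to ⇔-trans)
open import Level using (0ℓ)
open import Relation.Binary using (Rel)
open import Relation.Binary.Construct.Closure.ReflexiveTransitive as Star using (Star; ε; _◅_; _◅◅_; reverse)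
open import Relation.Binary.PropositionalEquality
open import Relation.Nullary using (¬_; Dec; yes; no; does; contradiction; ¬?)
open import Relation.Nullary.Decidable using (_×-dec_; _⊎-dec_; dec-true; from-yes; from-no)
open import Relation.Unary using (Decidable)

open import Algebra.Properties.Semiring.Sum (CommutativeRing.semiring +-*-commutativeRing)
  using (sum; sum-cong-≗; sum-replicate-zero; ∑-distrib-+; ∑-comm; *-distribˡ-sum; *-distribʳ-sum)
open import Algebra.Properties.Monoid.Sum *-1-monoid
  using () renaming (sum to product; sum-cong-≗ to product-cong)
open +-*-Solver using (solve; _:+_; _:*_; :-_; _:=_; con)
open ≡-Reasoning

-- Solvability of skew-symmetric systems

-- No determinants are used. `Solvable` keeps the matrix on all of `Fin n` and restricts only which
-- rows count and where the vector may be nonzero, so changing the vertex set needs no reindexing,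
-- and only for `⊤` is solvability compared with nonsingularity. Skew-symmetry enters through yᵀAx =
-- - xᵀAy: it makes the kernel of a solvable system trivial, which is how a zero row or an explicit
-- kernel vector refutes solvability. The combinatorial obstacle is that, without pendant vertices,
-- every remaining edge lies on the cycle. Instead of a decomposition into trees, simple paths are
-- grown from both ends of an edge; off the cycle, such an edge would lie on a second cycle.
-- Matchings of G and of G - C are treated at once by fixing a set Z of vertices that survive all
-- δ-transformations and matching only outside Z. In the converse direction the final set W is
-- whatever the membership supplies; the matching forces it to be empty, respectively to be the
-- vertex set of the cycle.

sum-zero : ∀ {n} (f : Fin n → ℚ) → (∀ i → f i ≡ 0ℚ) → sum f ≡ 0ℚ
sum-zero {n} f f≗0 = trans (sum-cong-≗ f≗0) (sum-replicate-zero n)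

sum-single : ∀ {n} (f : Fin n → ℚ) a → (∀ i → i ≢ a → f i ≡ 0ℚ) → sum f ≡ f a
sum-single f zero    off = trans (cong (f zero +_) (sum-zero (f ∘ suc) λ i → off (suc i) λ ())) (+-identityʳ _)
sum-single f (suc a) off = trans (cong₂ _+_ (off zero λ ())
                                         (sum-single (f ∘ suc) a λ i i≢a → off (suc i) λ { refl → i≢a refl }))
                                 (+-identityˡ _)

sum-pair : ∀ {n} (f : Fin n → ℚ) {a b} → a ≢ b → (∀ i → i ≢ a → i ≢ b → f i ≡ 0ℚ) → sum f ≡ f a + f b
sum-pair f {zero}  {zero}  a≢b off = contradiction refl a≢b
sum-pair f {zero}  {suc b} a≢b off =
  cong (f zero +_) (sum-single (f ∘ suc) b λ i i≢b → off (suc i) (λ ()) λ { refl → i≢b refl })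
sum-pair f {suc a} {zero}  a≢b off =
  trans (cong (f zero +_) (sum-single (f ∘ suc) a λ i i≢a → off (suc i) (λ { refl → i≢a refl }) λ ()))
        (solve 2 (λ x y → x :+ y := y :+ x) refl (f zero) (f (suc a)))
sum-pair f {suc a} {suc b} a≢b off =
  trans (cong₂ _+_ (off zero (λ ()) λ ())
                   (sum-pair (f ∘ suc) (a≢b ∘ cong suc)
                             λ i i≢a i≢b → off (suc i) (λ { refl → i≢a refl }) λ { refl → i≢b refl }))
        (+-identityˡ _)

𝟙-diag : ∀ {n} (i : Fin n) → 𝟙 i i ≡ 1ℚ
𝟙-diag i with i ≟ i
... | yes _ = refl
... | no ¬p = contradiction refl ¬p

𝟙-off : ∀ {n} {i j : Fin n} → i ≢ j → 𝟙 i j ≡ 0ℚ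
𝟙-off {i = i} {j} i≢j with i ≟ j
... | yes p = contradiction p i≢j
... | no _  = refl

𝟙-sym : ∀ {n} (i j : Fin n) → 𝟙 i j ≡ 𝟙 j i
𝟙-sym i j with i ≟ j
... | yes refl = sym (𝟙-diag i)
... | no i≢j   = sym (𝟙-off (i≢j ∘ sym))

infixr 7 _∙_
_∙_ : ∀ {n} → Matrix n → (Fin n → ℚ) → (Fin n → ℚ)
(A ∙ x) i = sum (λ j → A i j * x j)

∙-single : ∀ {n} (A : Matrix n) x a → (∀ j → j ≢ a → x j ≡ 0ℚ) → ∀ i → (A ∙ x) i ≡ A i a * x a
∙-single A x a off i = sum-single _ a λ j j≢a → trans (cong (A i j *_) (off j j≢a)) (*-zeroʳ (A i j))

𝟙-∙ : ∀ {n} (x : Fin n → ℚ) i → (𝟙 ∙ x) i ≡ x i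
𝟙-∙ x i = begin
  (𝟙 ∙ x) i    ≡⟨ sum-single _ i (λ j j≢i → trans (cong (_* x j) (𝟙-off (j≢i ∘ sym))) (*-zeroˡ (x j))) ⟩
  𝟙 i i * x i  ≡⟨ cong (_* x i) (𝟙-diag i) ⟩
  1ℚ * x i     ≡⟨ *-identityˡ _ ⟩
  x i          ∎

∙-add-unit : ∀ {n} (A : Matrix n) x c a i → (A ∙ (λ j → x j + c * 𝟙 j a)) i ≡ (A ∙ x) i + A i a * c
∙-add-unit A x c a i = begin
  sum (λ j → A i j * (x j + c * 𝟙 j a))
    ≡⟨ sum-cong-≗ (λ j → solve 4 (λ s y d e → s :* (y :+ d :* e)
          := s :* y :+ s :* (d :* e)) refl (A i j) (x j) c (𝟙 j a)) ⟩
  sum (λ j → A i j * x j + A i j * (c * 𝟙 j a))        ≡⟨ ∑-distrib-+ _ (λ j → A i j * (c * 𝟙 j a)) ⟩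
  (A ∙ x) i + (A ∙ (λ j → c * 𝟙 j a)) i
    ≡⟨ cong ((A ∙ x) i +_) (∙-single A _ a (λ j j≢a → trans (cong (c *_) (𝟙-off j≢a)) (*-zeroʳ c)) i) ⟩
  (A ∙ x) i + A i a * (c * 𝟙 a a)                      ≡⟨ cong (λ z → (A ∙ x) i + A i a * (c * z)) (𝟙-diag a) ⟩
  (A ∙ x) i + A i a * (c * 1ℚ)                         ≡⟨ cong (λ z → (A ∙ x) i + A i a * z) (*-identityʳ c) ⟩
  (A ∙ x) i + A i a * c                                ∎

∙-assoc : ∀ {n} (A B : Matrix n) x i → (A ∙ (B ∙ x)) i ≡ ((A · B) ∙ x) i
∙-assoc A B x i = begin
  sum (λ j → A i j * sum (λ k → B j k * x k))      ≡⟨ sum-cong-≗ (λ j → *-distribˡ-sum (A i j) (λ k → B j k * x k)) ⟩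
  sum (λ j → sum (λ k → A i j * (B j k * x k)))    ≡⟨ ∑-comm (λ j k → A i j * (B j k * x k)) ⟩
  sum (λ k → sum (λ j → A i j * (B j k * x k)))
    ≡⟨ sum-cong-≗ (λ k → sum-cong-≗ (λ j → solve 3 (λ a b c → a :* (b :* c)
          := a :* b :* c) refl (A i j) (B j k) (x k))) ⟩
  sum (λ k → sum (λ j → A i j * B j k * x k))      ≡⟨ sum-cong-≗ (λ k → *-distribʳ-sum (x k) (λ j → A i j * B j k)) ⟨
  sum (λ k → (A · B) i k * x k)                    ∎

∙-cong : ∀ {n} {A B : Matrix n} {x y} → (∀ i j → A i j ≡ B i j) → (∀ j → x j ≡ y j) → ∀ i → (A ∙ x) i ≡ (B ∙ y) i
∙-cong A≗B x≗y i = sum-cong-≗ λ j → cong₂ _*_ (A≗B i j) (x≗y j)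

Skew : ∀ {n} → Matrix n → Set
Skew A = ∀ i j → A j i ≡ - A i j

skew-diag : ∀ {n} {A : Matrix n} → Skew A → ∀ i → A i i ≡ 0ℚ
skew-diag {A = A} skew i = begin
  A i i                      ≡⟨ solve 1 (λ a → a := con ½ :* (a :+ a)) refl (A i i) ⟩
  ½ * (A i i + A i i)        ≡⟨ cong (λ z → ½ * (A i i + z)) (skew i i) ⟩
  ½ * (A i i + - A i i)      ≡⟨ solve 1 (λ a → con ½ :* (a :+ :- a) := con 0ℚ) refl (A i i) ⟩
  0ℚ                         ∎

skew-pairing : ∀ {n} {A : Matrix n} → Skew A → ∀ x y →
  sum (λ i → y i * (A ∙ x) i) ≡ sum (λ i → - x i * (A ∙ y) i)
skew-pairing {A = A} skew x y = begin
  sum (λ i → y i * sum (λ j → A i j * x j))        ≡⟨ sum-cong-≗ (λ i → *-distribˡ-sum (y i) (λ j → A i j * x j)) ⟩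
  sum (λ i → sum (λ j → y i * (A i j * x j)))      ≡⟨ ∑-comm (λ i j → y i * (A i j * x j)) ⟩
  sum (λ j → sum (λ i → y i * (A i j * x j)))      ≡⟨ sum-cong-≗ (λ j → sum-cong-≗ (λ i → transpose j i)) ⟩
  sum (λ j → sum (λ i → - x j * (A j i * y i)))    ≡⟨ sum-cong-≗ (λ j → *-distribˡ-sum (- x j) (λ i → A j i * y i)) ⟨
  sum (λ j → - x j * (A ∙ y) j)                    ∎
  where
  transpose : ∀ j i → y i * (A i j * x j) ≡ - x j * (A j i * y i)
  transpose j i = begin
    y i * (A i j * x j)      ≡⟨ solve 3 (λ u v w → u :* (v :* w) := :- w :* (:- v :* u)) refl (y i) (A i j) (x j) ⟩
    - x j * (- A i j * y i)  ≡⟨ cong (λ z → - x j * (z * y i)) (skew i j) ⟨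
    - x j * (A j i * y i)    ∎

-- Solvability of A[W] x = b for every b, with vectors on W extended by zero.
Solvable : ∀ {n} → Matrix n → Subset n → Set
Solvable {n} A W = (b : Fin n → ℚ) →
  Σ (Fin n → ℚ) λ x → (∀ i → i ∉ W → x i ≡ 0ℚ) × (∀ i → i ∈ W → (A ∙ x) i ≡ b i)

nonsingular⇒solvable : ∀ {n} {A : Matrix n} → Nonsingular A → Solvable A ⊤
nonsingular⇒solvable {A = A} (B , AB≗𝟙 , _) b =
  B ∙ b , (λ i i∉⊤ → contradiction ∈⊤ i∉⊤) ,
  λ i _ → trans (∙-assoc A B b i) (trans (∙-cong AB≗𝟙 (λ _ → refl) i) (𝟙-∙ b i))

-- A right inverse B gives the left inverse −Bᵀ, since A is skew-symmetric.
solvable⇒nonsingular : ∀ {n} {A : Matrix n} → Skew A → Solvable A ⊤ → Nonsingular A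
solvable⇒nonsingular {n} {A} skew sol = B , AB≗𝟙 , BA≗𝟙
  where
  B B′ : Matrix n
  B i j = proj₁ (sol (λ k → 𝟙 k j)) i
  B′ i j = - B j i

  AB≗𝟙 : ∀ i j → (A · B) i j ≡ 𝟙 i j
  AB≗𝟙 i j = proj₂ (proj₂ (sol (λ k → 𝟙 k j))) i ∈⊤

  B′A≗𝟙 : ∀ i j → (B′ · A) i j ≡ 𝟙 i j
  B′A≗𝟙 i j = begin
    sum (λ k → - B k i * A k j)  ≡⟨ sum-cong-≗ (λ k → cong (- B k i *_) (skew j k)) ⟩
    sum (λ k → - B k i * - A j k) ≡⟨ sum-cong-≗ (λ k → solve 2 (λ x y → :- x :* :- y := y :* x) refl (B k i) (A j k)) ⟩
    (A · B) j i                  ≡⟨ AB≗𝟙 j i ⟩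
    𝟙 j i                        ≡⟨ 𝟙-sym j i ⟩
    𝟙 i j                        ∎

  -- A left inverse equals a right inverse, B′ = B′(AB) = (B′A)B = B, computed on column j.
  B′≗B : ∀ i j → B′ i j ≡ B i j
  B′≗B i j = begin
    B′ i j                            ≡⟨ *-identityʳ _ ⟨
    B′ i j * 1ℚ                       ≡⟨ cong (B′ i j *_) (𝟙-diag j) ⟨
    B′ i j * 𝟙 j j                    ≡⟨ ∙-single B′ (λ k → 𝟙 k j) j (λ k k≢j → 𝟙-off k≢j) i ⟨
    (B′ ∙ (λ k → 𝟙 k j)) i            ≡⟨ ∙-cong {A = B′} (λ _ _ → refl) (λ k → sym (AB≗𝟙 k j)) i ⟩
    (B′ ∙ (A ∙ (λ k → B k j))) i      ≡⟨ ∙-assoc B′ A (λ k → B k j) i ⟩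
    ((B′ · A) ∙ (λ k → B k j)) i      ≡⟨ ∙-cong B′A≗𝟙 (λ _ → refl) i ⟩
    (𝟙 ∙ (λ k → B k j)) i             ≡⟨ 𝟙-∙ (λ k → B k j) i ⟩
    B i j                             ∎

  BA≗𝟙 : ∀ i j → (B · A) i j ≡ 𝟙 i j
  BA≗𝟙 i j = trans (sum-cong-≗ λ k → cong (_* A k j) (sym (B′≗B i k))) (B′A≗𝟙 i j)

-- With A x the unit vector at a on W, y a = yᵀAx = - xᵀAy = 0. Outside W nothing is known about A x
-- and A y, but there y and x vanish.
solvable⇒kernel-trivial : ∀ {n} {A : Matrix n} {W} → Skew A → Solvable A W →
  ∀ y → (∀ i → i ∉ W → y i ≡ 0ℚ) → (∀ i → i ∈ W → (A ∙ y) i ≡ 0ℚ) → ∀ a → y a ≡ 0ℚ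
solvable⇒kernel-trivial {A = A} {W} skew sol y y-off Ay≡0 a = begin
  y a                              ≡⟨ 𝟙-∙ y a ⟨
  sum (λ i → 𝟙 a i * y i)          ≡⟨ sum-cong-≗ (λ i → *-comm (𝟙 a i) (y i)) ⟩
  sum (λ i → y i * 𝟙 a i)          ≡⟨ sum-cong-≗ hit ⟨
  sum (λ i → y i * (A ∙ x) i)      ≡⟨ skew-pairing skew x y ⟩
  sum (λ i → - x i * (A ∙ y) i)    ≡⟨ sum-zero _ vanish ⟩
  0ℚ                               ∎
  where
  x = proj₁ (sol (𝟙 a))
  x-off = proj₁ (proj₂ (sol (𝟙 a)))
  Ax≡𝟙a = proj₂ (proj₂ (sol (𝟙 a)))

  hit : ∀ i → y i * (A ∙ x) i ≡ y i * 𝟙 a i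
  hit i with i ∈? W
  ... | yes i∈W = cong (y i *_) (Ax≡𝟙a i i∈W)
  ... | no  i∉W rewrite y-off i i∉W = trans (*-zeroˡ ((A ∙ x) i)) (sym (*-zeroˡ (𝟙 a i)))

  vanish : ∀ i → - x i * (A ∙ y) i ≡ 0ℚ
  vanish i with i ∈? W
  ... | yes i∈W = trans (cong (- x i *_) (Ay≡0 i i∈W)) (*-zeroʳ (- x i))
  ... | no  i∉W rewrite x-off i i∉W = *-zeroˡ ((A ∙ y) i)

-- The unit vector at a would lie in the kernel: the hypothesis is a zero column, which for a skew
-- matrix is a zero row.
solvable⇒no-zero-row : ∀ {n} {A : Matrix n} {W} → Skew A → Solvable A W →
  ∀ {a} → a ∈ W → ¬ (∀ i → i ∈ W → A i a ≡ 0ℚ)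
solvable⇒no-zero-row {A = A} {W} skew sol {a} a∈W Aa≡0 =
  1≢0 (trans (sym (𝟙-diag a))
             (solvable⇒kernel-trivial skew sol (λ j → 𝟙 j a) off kernel a))
  where
  off : ∀ i → i ∉ W → 𝟙 i a ≡ 0ℚ
  off i i∉W = 𝟙-off {i = i} {a} λ { refl → i∉W a∈W }

  kernel : ∀ i → i ∈ W → (A ∙ (λ j → 𝟙 j a)) i ≡ 0ℚ
  kernel i i∈W = trans (∙-single A _ a (λ j → 𝟙-off) i)
                       (trans (cong (_* 𝟙 a a) (Aa≡0 i i∈W)) (*-zeroˡ (𝟙 a a)))

-- Linear systems along a cycle

IsSign : ℚ → Set
IsSign q = q ≡ 1ℚ ⊎ q ≡ - 1ℚ

sign-square : ∀ {q} → IsSign q → q * q ≡ 1ℚ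
sign-square (inj₁ refl) = refl
sign-square (inj₂ refl) = refl

sign-* : ∀ {p q} → IsSign p → IsSign q → IsSign (p * q)
sign-* (inj₁ refl) (inj₁ refl) = inj₁ refl
sign-* (inj₁ refl) (inj₂ refl) = inj₂ refl
sign-* (inj₂ refl) (inj₁ refl) = inj₂ refl
sign-* (inj₂ refl) (inj₂ refl) = inj₁ refl

-- Vectors on a cycle of length k are read as k-periodic sequences on ℕ, so that recurrences can be
-- stated without remainders.
Periodic : ℕ → (ℕ → ℚ) → Set
Periodic k f = ∀ m → f (m ℕ.+ k) ≡ f m

prod : (ℕ → ℚ) → ℕ → ℚ
prod f zero    = 1ℚ
prod f (suc m) = f m * prod f m

prod-cong : ∀ {f g} → (∀ m → f m ≡ g m) → ∀ m → prod f m ≡ prod g m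
prod-cong f≗g zero    = refl
prod-cong f≗g (suc m) = cong₂ _*_ (f≗g m) (prod-cong f≗g m)

prod-sign : ∀ {f} → (∀ m → IsSign (f m)) → ∀ m → IsSign (prod f m)
prod-sign sgn zero    = inj₁ refl
prod-sign sgn (suc m) = sign-* (sgn m) (prod-sign sgn m)

prod-head : ∀ f m → prod f (suc m) ≡ f 0 * prod (f ∘ suc) m
prod-head f zero    = refl
prod-head f (suc m) = begin
  f (suc m) * prod f (suc m)                ≡⟨ cong (f (suc m) *_) (prod-head f m) ⟩
  f (suc m) * (f 0 * prod (f ∘ suc) m)
    ≡⟨ solve 3 (λ a b c → a :* (b :* c) := b :* (a :* c)) refl (f (suc m)) (f 0) (prod (f ∘ suc) m) ⟩
  f 0 * (f (suc m) * prod (f ∘ suc) m)      ∎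

product-toℕ : ∀ f k → product {k} (λ i → f (toℕ i)) ≡ prod f k
product-toℕ f zero    = refl
product-toℕ f (suc k) = trans (cong (f 0 *_) (product-toℕ (f ∘ suc) k)) (sym (prod-head f k))

prod-period : ∀ {f k} → Periodic k f → ∀ m → prod f (m ℕ.+ k) ≡ prod f m * prod f k
prod-period {f} {k} per zero    = solve 1 (λ a → a := con 1ℚ :* a) refl (prod f k)
prod-period {f} {k} per (suc m) = begin
  f (m ℕ.+ k) * prod f (m ℕ.+ k)     ≡⟨ cong₂ _*_ (per m) (prod-period per m) ⟩
  f m * (prod f m * prod f k)
    ≡⟨ solve 3 (λ a b c → a :* (b :* c) := a :* b :* c) refl (f m) (prod f m) (prod f k) ⟩
  f m * prod f m * prod f k          ∎

-- (- 1)^m = - 1 unless m is even; the recursion in steps of two settles the parity on the way.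
prod-neg : ∀ f m → 2 ∣ m ⊎ prod (λ i → - 1ℚ * f i) m ≡ - prod f m
prod-neg f zero          = inj₁ (divides 0 refl)
prod-neg f (suc zero)    = inj₂ (solve 1 (λ a → con (- 1ℚ) :* a :* con 1ℚ := :- (a :* con 1ℚ)) refl (f 0))
prod-neg f (suc (suc m)) with prod-neg f m
... | inj₁ 2∣m = inj₁ (∣m∣n⇒∣m+n ∣-refl 2∣m)
... | inj₂ eq  = inj₂ (begin
  - 1ℚ * f (suc m) * (- 1ℚ * f m * prod (λ i → - 1ℚ * f i) m)  ≡⟨ cong (λ z → - 1ℚ * f (suc m) * (- 1ℚ * f m * z)) eq ⟩
  - 1ℚ * f (suc m) * (- 1ℚ * f m * - prod f m)
    ≡⟨ solve 3 (λ a b c → con (- 1ℚ) :* a :* (con (- 1ℚ) :* b :* :- c)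
          := :- (a :* (b :* c))) refl (f (suc m)) (f m) (prod f m) ⟩
  - (f (suc m) * (f m * prod f m))                             ∎)

-- The action of S(C_k) on a vector X read along the cycle.
cyclic : (σ X : ℕ → ℚ) → ℕ → ℚ
cyclic σ X m = σ (suc m) * X (suc (suc m)) + - σ m * X m

-- Two steps of the product multiply it by c²σₘ₊₁σₘ = σₘ₊₁σₘ, and the factor σₘ₊₁ in `cyclic`
-- cancels one sign. Only the periodicity of the sequence depends on c.
cyclic-kernel : ∀ {σ} → (∀ m → IsSign (σ m)) → ∀ {c} → IsSign c → ∀ m → cyclic σ (prod (λ i → c * σ i)) m ≡ 0ℚ
cyclic-kernel {σ} sgn {c} sgn-c m = begin
  s * (c * s * (c * t * p)) + - t * p
    ≡⟨ solve 4 (λ s c t p → s :* (c :* s :* (c :* t :* p)) :+ :- t :* p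
          := s :* s :* (c :* c) :* (t :* p) :+ :- t :* p) refl s c t p ⟩
  s * s * (c * c) * (t * p) + - t * p
    ≡⟨ cong₂ (λ x y → x * y * (t * p) + - t * p) (sign-square (sgn (suc m))) (sign-square sgn-c) ⟩
  1ℚ * 1ℚ * (t * p) + - t * p
    ≡⟨ solve 2 (λ t p → con 1ℚ :* con 1ℚ :* (t :* p) :+ :- t :* p := con 0ℚ) refl t p ⟩
  0ℚ ∎
  where
  s = σ (suc m)
  t = σ m
  p = prod (λ i → c * σ i) m

-- Substituting X = τ y with τ = prod σ turns the system into y₂₊ₘ = yₘ + c₁₊ₘ,
-- and X is k-periodic exactly when y is k-antiperiodic, since P = − 1 makes τ k-antiperiodic.
module _ {σ : ℕ → ℚ} {h} (sgn : ∀ m → IsSign (σ m)) (per : Periodic (h ℕ.* 2) σ)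
         (P≡-1 : prod σ (h ℕ.* 2) ≡ - 1ℚ) {b : ℕ → ℚ} (b-per : Periodic (h ℕ.* 2) b) where
  private
    k = h ℕ.* 2

    τ c y : ℕ → ℚ
    τ = prod σ
    c m = τ m * b m

    -- `S j m` = c₁₊ₘ + c₃₊ₘ + ⋯ (j terms) is the increment of y over 2j indices.
    S : ℕ → ℕ → ℚ
    S zero    m = 0ℚ
    S (suc j) m = S j m + c (suc (j ℕ.* 2 ℕ.+ m))

    -- The recurrence links indices of equal parity, so there are two free initial values.
    -- Antiperiodicity demands y₀ + `S h 0` = - y₀ and y₁ + `S h 1` = - y₁, which fixes both.
    y zero          = - ½ * S h 0
    y (suc zero)    = - ½ * S h 1
    y (suc (suc m)) = y m + c (suc m)

    τ-anti : ∀ m → τ (m ℕ.+ k) ≡ - τ m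
    τ-anti m = begin
      τ (m ℕ.+ k)     ≡⟨ prod-period {σ} per m ⟩
      τ m * τ k       ≡⟨ cong (τ m *_) P≡-1 ⟩
      τ m * - 1ℚ      ≡⟨ solve 1 (λ a → a :* con (- 1ℚ) := :- a) refl (τ m) ⟩
      - τ m           ∎

    c-anti : ∀ m → c (m ℕ.+ k) ≡ - c m
    c-anti m = trans (cong₂ _*_ (τ-anti m) (b-per m)) (solve 2 (λ x y → :- x :* y := :- (x :* y)) refl (τ m) (b m))

    y-sum : ∀ j m → y (j ℕ.* 2 ℕ.+ m) ≡ y m + S j m
    y-sum zero    m = solve 1 (λ a → a := a :+ con 0ℚ) refl (y m)
    y-sum (suc j) m = trans (cong (_+ c (suc (j ℕ.* 2 ℕ.+ m))) (y-sum j m))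
      (solve 3 (λ x y z → x :+ y :+ z := x :+ (y :+ z)) refl (y m) (S j m) (c (suc (j ℕ.* 2 ℕ.+ m))))

    half : ∀ s → - ½ * s + s ≡ - (- ½ * s)
    half = solve 1 (λ s → con (- ½) :* s :+ s := :- (con (- ½) :* s)) refl

    y-anti : ∀ m → y (m ℕ.+ k) ≡ - y m
    y-anti zero          = trans (cong y (sym (ℕ.+-identityʳ k))) (trans (y-sum h 0) (half (S h 0)))
    y-anti (suc zero)    = trans (cong y (ℕ.+-comm 1 k)) (trans (y-sum h 1) (half (S h 1)))
    y-anti (suc (suc m)) = trans (cong₂ _+_ (y-anti m) (c-anti (suc m)))
      (solve 2 (λ x z → :- x :+ :- z := :- (x :+ z)) refl (y m) (c (suc m)))

  cyclic-solution : Σ (ℕ → ℚ) λ X → Periodic k X × (∀ m → cyclic σ X m ≡ b (suc m))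
  cyclic-solution = (λ m → τ m * y m) , periodic , solution
    where
    periodic : Periodic k (λ m → τ m * y m)
    periodic m = trans (cong₂ _*_ (τ-anti m) (y-anti m)) (solve 2 (λ x z → :- x :* :- z := x :* z) refl (τ m) (y m))

    solution : ∀ m → cyclic σ (λ m → τ m * y m) m ≡ b (suc m)
    solution m = begin
      s * (s * (t * p) * (z + t * p * d)) + - t * (p * z)
        ≡⟨ solve 5 (λ s t p z d → s :* (s :* (t :* p) :* (z :+ t :* p :* d)) :+ :- t :* (p :* z)
                     := s :* s :* (t :* p :* z :+ t :* t :* (p :* p) :* d) :+ :- t :* (p :* z)) refl s t p z d ⟩
      s * s * (t * p * z + t * t * (p * p) * d) + - t * (p * z)
        ≡⟨ cong (λ w → w * (t * p * z + t * t * (p * p) * d) + - t * (p * z)) (sign-square (sgn (suc m))) ⟩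
      1ℚ * (t * p * z + t * t * (p * p) * d) + - t * (p * z)
        ≡⟨ cong₂ (λ v w → 1ℚ * (t * p * z + v * w * d) + - t * (p * z))
                 (sign-square (sgn m)) (sign-square (prod-sign sgn m)) ⟩
      1ℚ * (t * p * z + 1ℚ * 1ℚ * d) + - t * (p * z)
        ≡⟨ solve 4 (λ t p z d → con 1ℚ :* (t :* p :* z :+ con 1ℚ :* con 1ℚ :* d) :+ :- t :* (p :* z)
              := d) refl t p z d ⟩
      d ∎
      where
      s = σ (suc m)
      t = σ m
      p = τ m
      z = y m
      d = b (suc m)

-- Pendant vertices

∈-tabulate⁺ : ∀ {n} {P : Fin n → Set} (P? : Decidable P) {i} → P i → i ∈ tabulate (λ j → does (P? j))
∈-tabulate⁺ P? {i} Pi = lookup⇒[]= i _ (trans (lookup∘tabulate (does ∘ P?) i) (dec-true (P? i) Pi))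

∈-tabulate⁻ : ∀ {n} {P : Fin n → Set} (P? : Decidable P) {i} → i ∈ tabulate (λ j → does (P? j)) → P i
∈-tabulate⁻ P? {i} i∈ with P? i | trans (sym (lookup∘tabulate (does ∘ P?) i)) ([]=⇒lookup i∈)
... | yes Pi | _  = Pi
... | no _   | ()

x∈p─q⇒x∉q : ∀ {n} (p q : Subset n) {x} → x ∈ p ─ q → x ∉ q
x∈p─q⇒x∉q (_ ∷ p) (_ ∷ q)      (there x∈) (there x∈q) = x∈p─q⇒x∉q p q x∈ x∈q
x∈p─q⇒x∉q (_ ∷ p) (inside ∷ q) ()         here

∣p∣≡1⇒unique : ∀ {n} {p : Subset n} {x y} → ∣ p ∣ ≡ 1 → x ∈ p → y ∈ p → x ≡ y
∣p∣≡1⇒unique {p = p} {x} {y} ∣p∣≡1 x∈p y∈p with x ≟ y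
... | yes x≡y = x≡y
... | no x≢y  = contradiction (ℕ.≤-trans 1≤∣p-y∣ (ℕ.≤-pred (subst (∣ p ∖ y ∣ ℕ.<_) ∣p∣≡1 (x∈p⇒∣p-x∣<∣p∣ y∈p)))) λ ()
  where
  1≤∣p-y∣ : 1 ℕ.≤ ∣ p ∖ y ∣
  1≤∣p-y∣ = subst (ℕ._≤ ∣ p ∖ y ∣) (∣⁅x⁆∣≡1 x)
    (p⊆q⇒∣p∣≤∣q∣ λ z∈ → subst (_∈ p ∖ y) (sym (x∈⁅y⁆⇒x≡y x z∈)) (x∈p∧x≢y⇒x∈p-y x∈p x≢y))

∣p∣≢1⇒another : ∀ {n} {p : Subset n} {x} → ∣ p ∣ ≢ 1 → x ∈ p → ∃ λ y → y ∈ p × y ≢ x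
∣p∣≢1⇒another {p = p} {x} ∣p∣≢1 x∈p with any? (λ y → (y ∈? p) ×-dec ¬? (y ≟ x))
... | yes another = another
... | no  none    = contradiction (trans (cong ∣_∣ (⊆-antisym p⊆⁅x⁆ ⁅x⁆⊆p)) (∣⁅x⁆∣≡1 x)) ∣p∣≢1
  where
  p⊆⁅x⁆ : p ⊆ ⁅ x ⁆
  p⊆⁅x⁆ {y} y∈p with y ≟ x
  ... | yes refl = x∈⁅x⁆ x
  ... | no y≢x   = contradiction (y , y∈p , y≢x) none

  ⁅x⁆⊆p : ⁅ x ⁆ ⊆ p
  ⁅x⁆⊆p z∈ = subst (_∈ p) (sym (x∈⁅y⁆⇒x≡y x z∈)) x∈p

∣p∣≡1⇒nonempty : ∀ {n} {p : Subset n} → ∣ p ∣ ≡ 1 → ∃ λ x → x ∈ p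
∣p∣≡1⇒nonempty {n} {p} ∣p∣≡1 with nonempty? p
... | yes ne = ne
... | no ¬ne with () ← trans (sym ∣p∣≡1) (trans (cong ∣_∣ (Empty-unique ¬ne)) (∣⊥∣≡0 n))

module _ {n} (G : OrientedGraph n) where
  open OrientedGraph G

  private
    S = skewAdjacency

  ~-sym : ∀ {u v} → u ~ v → v ~ u
  ~-sym = swap

  ~-irrefl : ∀ {u} → ¬ u ~ u
  ~-irrefl (inj₁ u⟶u) = asym u⟶u u⟶u
  ~-irrefl (inj₂ u⟶u) = asym u⟶u u⟶u

  skewAdjacency-skew : Skew S
  skewAdjacency-skew u v with u ⟶? v | v ⟶? u
  ... | yes u⟶v | yes v⟶u = contradiction v⟶u (asym u⟶v)
  ... | yes _   | no _    = refl
  ... | no _    | yes _   = refl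
  ... | no _    | no _    = refl

  skewAdjacency-edge : ∀ {u v} → u ~ v → IsSign (S u v)
  skewAdjacency-edge {u} {v} u~v with u ⟶? v | v ⟶? u
  ... | yes _   | _      = inj₁ refl
  ... | no _    | yes _  = inj₂ refl
  ... | no ¬u⟶v | no ¬v⟶u with u~v
  ...   | inj₁ u⟶v = contradiction u⟶v ¬u⟶v
  ...   | inj₂ v⟶u = contradiction v⟶u ¬v⟶u

  skewAdjacency-nonEdge : ∀ {u v} → ¬ u ~ v → S u v ≡ 0ℚ
  skewAdjacency-nonEdge {u} {v} u≁v with u ⟶? v | v ⟶? u
  ... | yes u⟶v | _       = contradiction (inj₁ u⟶v) u≁v
  ... | no _    | yes v⟶u = contradiction (inj₂ v⟶u) u≁v
  ... | no _    | no _    = refl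

  ∈-neighbours⁺ : ∀ {W v u} → u ∈ W → v ~ u → u ∈ neighbours G W v
  ∈-neighbours⁺ {v = v} u∈W v~u = x∈p∩q⁺ (u∈W , ∈-tabulate⁺ (v ~?_) v~u)

  ∈-neighbours⁻ : ∀ {W v u} → u ∈ neighbours G W v → u ∈ W × v ~ u
  ∈-neighbours⁻ {W} {v} u∈N with u∈W , u∈ ← x∈p∩q⁻ W _ u∈N = u∈W , ∈-tabulate⁻ (v ~?_) u∈

  -- A δ-transformation with the degree replaced by uniqueness of the neighbour and the resulting
  -- set described by membership. In this form it survives the removal of further vertices from both
  -- sets.
  record PendantPair (W W′ : Subset n) : Set where
    field
      p q     : Fin n
      p∈W     : p ∈ W
      q∈W     : q ∈ W
      p~q     : p ~ q
      unique  : ∀ {u} → u ∈ W → p ~ u → u ≡ q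
      rest⁻   : ∀ {u} → u ∈ W′ → u ∈ W × u ≢ p × u ≢ q
      rest⁺   : ∀ {u} → u ∈ W → u ≢ p → u ≢ q → u ∈ W′

    p∉W′ : p ∉ W′
    p∉W′ p∈W′ = proj₁ (proj₂ (rest⁻ p∈W′)) refl

    q∉W′ : q ∉ W′
    q∉W′ q∈W′ = proj₂ (proj₂ (rest⁻ q∈W′)) refl

    p≢q : p ≢ q
    p≢q p≡q = ~-irrefl (subst (_~ q) p≡q p~q)

    p≁W′ : ∀ {u} → u ∈ W′ → ¬ p ~ u
    p≁W′ u∈W′ p~u = q∉W′ (subst (_∈ W′) (unique (proj₁ (rest⁻ u∈W′)) p~u) u∈W′)

  pendantPair : ∀ {W W′} → δ-Transformation G W W′ → PendantPair W W′
  pendantPair {W} {W′} t = record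
    { p = pendant ; q = neighbour ; p∈W = pendant∈W
    ; q∈W = proj₁ (∈-neighbours⁻ neighbour∈)
    ; p~q = proj₂ (∈-neighbours⁻ neighbour∈)
    ; unique = λ u∈W p~u → ∣p∣≡1⇒unique degree≡1 (∈-neighbours⁺ u∈W p~u) neighbour∈
    ; rest⁻ = λ u∈W′ → rest (subst (_ ∈_) result u∈W′)
    ; rest⁺ = λ u∈W u≢p u≢q → subst (_ ∈_) (sym result) (x∈p∧x≢y⇒x∈p-y (x∈p∧x≢y⇒x∈p-y u∈W u≢p) u≢q)
    }
    where
    open δ-Transformation t
    rest : ∀ {u} → u ∈ W ∖ pendant ∖ neighbour → u ∈ W × u ≢ pendant × u ≢ neighbour
    rest u∈ = p─q⊆p W _ (p─q⊆p (W ∖ pendant) _ u∈)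
            , (λ { refl → x∈p─q⇒x∉q W _ (p─q⊆p (W ∖ pendant) _ u∈) (x∈⁅x⁆ _) })
            , (λ { refl → x∈p─q⇒x∉q (W ∖ pendant) _ u∈ (x∈⁅x⁆ _) })

  -- Since Z survives the step, p and q lie outside Z, and a unique neighbour stays unique in a
  -- smaller set.
  pendantPair-∩ : ∀ {W W′ Z} → Z ⊆ W′ → PendantPair W W′ → PendantPair (W ∩ ∁ Z) (W′ ∩ ∁ Z)
  pendantPair-∩ {W} {W′} {Z} Z⊆W′ pp = record
    { p = p ; q = q
    ; p∈W = x∈p∩q⁺ (p∈W , x∉p⇒x∈∁p (p∉W′ ∘ Z⊆W′))
    ; q∈W = x∈p∩q⁺ (q∈W , x∉p⇒x∈∁p (q∉W′ ∘ Z⊆W′))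
    ; p~q = p~q
    ; unique = λ u∈ → unique (proj₁ (x∈p∩q⁻ W _ u∈))
    ; rest⁻ = λ u∈ → let u∈W′ , u∈∁Z = x∈p∩q⁻ W′ _ u∈ ; u∈W , ≢s = rest⁻ u∈W′
                     in x∈p∩q⁺ (u∈W , u∈∁Z) , ≢s
    ; rest⁺ = λ u∈ u≢p u≢q → let u∈W , u∈∁Z = x∈p∩q⁻ W _ u∈
                             in x∈p∩q⁺ (rest⁺ u∈W u≢p u≢q , u∈∁Z)
    }
    where open PendantPair pp

  -- Solvability and matchings across one pendant pair

  module _ {W W′} (pp : PendantPair W W′) where
    open PendantPair pp

    private
      s² : S p q * S p q ≡ 1ℚ
      s² = sign-square (skewAdjacency-edge p~q)

      Sup≡0 : ∀ {u} → u ∈ W′ → S u p ≡ 0ℚ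
      Sup≡0 u∈W′ = skewAdjacency-nonEdge (p≁W′ u∈W′ ∘ ~-sym)

    -- The right-hand side is set to 0 at p, so row p forces x q = 0. The entry x p can then be
    -- cleared, because no vertex of W′ is adjacent to p.
    solvable-restrict : Solvable S W → Solvable S W′
    solvable-restrict sol b = x′ , off , hit
      where
      b′ : Fin n → ℚ
      b′ i with i ≟ p
      ... | yes _ = 0ℚ
      ... | no _  = b i

      b′p≡0 : b′ p ≡ 0ℚ
      b′p≡0 with p ≟ p
      ... | yes _ = refl
      ... | no ¬r = contradiction refl ¬r

      b′≡b : ∀ {i} → i ≢ p → b′ i ≡ b i
      b′≡b {i} i≢p with i ≟ p
      ... | yes r = contradiction r i≢p
      ... | no _  = refl

      x x′ : Fin n → ℚ
      x = proj₁ (sol b′)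
      x′ i = x i + - (x p) * 𝟙 i p

      x-off = proj₁ (proj₂ (sol b′))
      x-hit = proj₂ (proj₂ (sol b′))

      row-p : (S ∙ x) p ≡ S p q * x q
      row-p = sum-single _ q vanish
        where
        vanish : ∀ j → j ≢ q → S p j * x j ≡ 0ℚ
        vanish j j≢q with j ∈? W
        ... | yes j∈W = trans (cong (_* x j) (skewAdjacency-nonEdge (j≢q ∘ unique j∈W))) (*-zeroˡ (x j))
        ... | no j∉W  = trans (cong (S p j *_) (x-off j j∉W)) (*-zeroʳ (S p j))

      xq≡0 : x q ≡ 0ℚ
      xq≡0 = begin
        x q                      ≡⟨ *-identityˡ (x q) ⟨
        1ℚ * x q                 ≡⟨ cong (_* x q) s² ⟨
        S p q * S p q * x q      ≡⟨ solve 2 (λ s z → s :* s :* z := s :* (s :* z)) refl (S p q) (x q) ⟩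
        S p q * (S p q * x q)    ≡⟨ cong (S p q *_) (trans (sym row-p) (trans (x-hit p p∈W) b′p≡0)) ⟩
        S p q * 0ℚ               ≡⟨ *-zeroʳ (S p q) ⟩
        0ℚ                       ∎

      x′≡x : ∀ {i} → i ≢ p → x′ i ≡ x i
      x′≡x {i} i≢p = trans (cong (λ z → x i + - (x p) * z) (𝟙-off i≢p))
                           (solve 2 (λ y z → y :+ z :* con 0ℚ := y) refl (x i) (- (x p)))

      x′p≡0 : x′ p ≡ 0ℚ
      x′p≡0 = trans (cong (λ z → x p + - (x p) * z) (𝟙-diag p))
                    (solve 1 (λ y → y :+ :- y :* con 1ℚ := con 0ℚ) refl (x p))

      off : ∀ i → i ∉ W′ → x′ i ≡ 0ℚ
      off i i∉W′ = off-cases (i ≟ p) (i ≟ q)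
        where
        off-cases : Dec (i ≡ p) → Dec (i ≡ q) → x′ i ≡ 0ℚ
        off-cases (yes i≡p) _         = trans (cong x′ i≡p) x′p≡0
        off-cases (no i≢p)  (yes i≡q) = trans (x′≡x i≢p) (trans (cong x i≡q) xq≡0)
        off-cases (no i≢p)  (no i≢q)  = trans (x′≡x i≢p) (x-off i λ i∈W → i∉W′ (rest⁺ i∈W i≢p i≢q))

      hit : ∀ i → i ∈ W′ → (S ∙ x′) i ≡ b i
      hit i i∈W′ = begin
        (S ∙ x′) i                       ≡⟨ ∙-add-unit S x (- (x p)) p i ⟩
        (S ∙ x) i + S i p * - (x p)    ≡⟨ cong₂ _+_ (x-hit i (proj₁ (rest⁻ i∈W′))) (cong (_* - (x p)) (Sup≡0 i∈W′)) ⟩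
        b′ i + 0ℚ * - (x p)            ≡⟨ solve 2 (λ y z → y :+ con 0ℚ :* z := y) refl (b′ i) (- (x p)) ⟩
        b′ i                             ≡⟨ b′≡b (proj₁ (proj₂ (rest⁻ i∈W′))) ⟩
        b i                              ∎

    -- Row p determines x q; the rows of W′ then the entries on W′; row q the entry x p.
    solvable-extend : Solvable S W′ → Solvable S W
    solvable-extend sol b = x , off , hit
      where
      s y r : ℚ
      s = S p q
      y = s * b p

      x₀ x₁ x : Fin n → ℚ
      x₀ = proj₁ (sol (λ i → b i + - (S i q * y)))
      x₁ i = x₀ i + y * 𝟙 i q
      x i = x₁ i + r * 𝟙 i p

      -- Row q reads (S x₀) q - s r = b q, and s is its own inverse; in the same way `y` is the
      -- solution of s y = b p.
      r = - s * (b q + - ((S ∙ x₀) q))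

      x₀-off = proj₁ (proj₂ (sol (λ i → b i + - (S i q * y))))
      x₀-hit = proj₂ (proj₂ (sol (λ i → b i + - (S i q * y))))

      row : ∀ i → (S ∙ x) i ≡ (S ∙ x₀) i + S i q * y + S i p * r
      row i = trans (∙-add-unit S x₁ r p i) (cong (_+ S i p * r) (∙-add-unit S x₀ y q i))

      off : ∀ i → i ∉ W → x i ≡ 0ℚ
      off i i∉W = begin
        x₀ i + y * 𝟙 i q + r * 𝟙 i p
          ≡⟨ cong₂ (λ u v → x₀ i + y * u + r * v) (𝟙-off {i = i} {q} λ { refl → i∉W q∈W })
                   (𝟙-off {i = i} {p} λ { refl → i∉W p∈W }) ⟩
        x₀ i + y * 0ℚ + r * 0ℚ        ≡⟨ solve 3 (λ x y r → x :+ y :* con 0ℚ :+ r :* con 0ℚ := x) refl (x₀ i) y r ⟩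
        x₀ i                          ≡⟨ x₀-off i (i∉W ∘ proj₁ ∘ rest⁻) ⟩
        0ℚ                            ∎

      row-p : (S ∙ x₀) p ≡ 0ℚ
      row-p = sum-zero _ vanish
        where
        vanish : ∀ j → S p j * x₀ j ≡ 0ℚ
        vanish j with j ∈? W′
        ... | yes j∈W′ = trans (cong (_* x₀ j) (skewAdjacency-nonEdge (p≁W′ j∈W′))) (*-zeroˡ (x₀ j))
        ... | no j∉W′  = trans (cong (S p j *_) (x₀-off j j∉W′)) (*-zeroʳ (S p j))

      hit : ∀ i → i ∈ W → (S ∙ x) i ≡ b i
      hit i i∈W with i ≟ p
      ... | yes refl = begin
        (S ∙ x) p                              ≡⟨ row p ⟩
        (S ∙ x₀) p + s * (s * b p) + S p p * r
          ≡⟨ cong₂ (λ u v → u + s * (s * b p) + v * r) row-p (skew-diag skewAdjacency-skew p) ⟩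
        0ℚ + s * (s * b p) + 0ℚ * r
          ≡⟨ solve 3 (λ s b r → con 0ℚ :+ s :* (s :* b) :+ con 0ℚ :* r := s :* s :* b) refl s (b p) r ⟩
        s * s * b p                            ≡⟨ cong (_* b p) s² ⟩
        1ℚ * b p                               ≡⟨ *-identityˡ (b p) ⟩
        b p                                    ∎
      ... | no i≢p with i ≟ q
      ...   | yes refl = begin
        (S ∙ x) q                              ≡⟨ row q ⟩
        z + S q q * y + S q p * r
          ≡⟨ cong₂ (λ u v → z + u * y + v * r) (skew-diag skewAdjacency-skew q) (skewAdjacency-skew p q) ⟩
        z + 0ℚ * y + - s * r
          ≡⟨ solve 4 (λ z y s b → z :+ con 0ℚ :* y :+ :- s :* (:- s :* (b :+ :- z))
                := z :+ s :* s :* (b :+ :- z)) refl z y s (b q) ⟩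
        z + s * s * (b q + - z)              ≡⟨ cong (λ u → z + u * (b q + - z)) s² ⟩
        z + 1ℚ * (b q + - z)                 ≡⟨ solve 2 (λ z b → z :+ con 1ℚ :* (b :+ :- z) := b) refl z (b q) ⟩
        b q                                    ∎
        where z = (S ∙ x₀) q
      ...   | no i≢q = begin
        (S ∙ x) i                                            ≡⟨ row i ⟩
        (S ∙ x₀) i + S i q * y + S i p * r
          ≡⟨ cong₂ (λ u v → u + S i q * y + v * r) (x₀-hit i i∈W′) (Sup≡0 i∈W′) ⟩
        b i + - (S i q * y) + S i q * y + 0ℚ * r
          ≡⟨ solve 3 (λ b w r → b :+ :- w :+ w :+ con 0ℚ :* r := b) refl (b i) (S i q * y) r ⟩
        b i                                                  ∎
        where i∈W′ = rest⁺ i∈W i≢p i≢q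

    perfectMatching-extend : PerfectMatching G W′ → PerfectMatching G W
    perfectMatching-extend pm = record { M = M⁺ ; M-sym = M⁺-sym ; M-edges = M⁺-edges ; covers = M⁺-covers }
      where
      open PerfectMatching pm

      M⁺ : Fin n → Fin n → Set
      M⁺ u v = M u v ⊎ (u ≡ p × v ≡ q) ⊎ (u ≡ q × v ≡ p)

      M⁺-sym : ∀ {u v} → M⁺ u v → M⁺ v u
      M⁺-sym (inj₁ m)                 = inj₁ (M-sym m)
      M⁺-sym (inj₂ (inj₁ (u≡p , v≡q))) = inj₂ (inj₂ (v≡q , u≡p))
      M⁺-sym (inj₂ (inj₂ (u≡q , v≡p))) = inj₂ (inj₁ (v≡p , u≡q))

      M⁺-edges : ∀ {u v} → M⁺ u v → u ∈ W × v ∈ W × u ~ v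
      M⁺-edges (inj₁ m) with u∈W′ , v∈W′ , u~v ← M-edges m = proj₁ (rest⁻ u∈W′) , proj₁ (rest⁻ v∈W′) , u~v
      M⁺-edges (inj₂ (inj₁ (refl , refl))) = p∈W , q∈W , p~q
      M⁺-edges (inj₂ (inj₂ (refl , refl))) = q∈W , p∈W , ~-sym p~q

      M⁺-covers : ∀ {u} → u ∈ W → ∃ λ v → M⁺ u v × (∀ {w} → M⁺ u w → v ≡ w)
      M⁺-covers {u} u∈W with u ≟ p
      ... | yes refl = q , inj₂ (inj₁ (refl , refl)) , λ
        { (inj₁ m)                 → contradiction (proj₁ (M-edges m)) p∉W′
        ; (inj₂ (inj₁ (_ , w≡q)))  → sym w≡q
        ; (inj₂ (inj₂ (p≡q , _)))  → contradiction p≡q p≢q }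
      ... | no u≢p with u ≟ q
      ...   | yes refl = p , inj₂ (inj₂ (refl , refl)) , λ
        { (inj₁ m)                 → contradiction (proj₁ (M-edges m)) q∉W′
        ; (inj₂ (inj₁ (q≡p , _)))  → contradiction (sym q≡p) p≢q
        ; (inj₂ (inj₂ (_ , w≡p)))  → sym w≡p }
      ...   | no u≢q with v , m , v-unique ← covers (rest⁺ u∈W u≢p u≢q) = v , inj₁ m , λ
        { (inj₁ m′)                → v-unique m′
        ; (inj₂ (inj₁ (u≡p , _)))  → contradiction u≡p u≢p
        ; (inj₂ (inj₂ (u≡q , _)))  → contradiction u≡q u≢q }

    -- The only possible partner of p is q, so a vertex of W′ is matched to neither of them.
    perfectMatching-restrict : PerfectMatching G W → PerfectMatching G W′
    perfectMatching-restrict pm = record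
      { M       = λ u v → M u v × u ∈ W′ × v ∈ W′
      ; M-sym   = λ { (m , u∈W′ , v∈W′) → M-sym m , v∈W′ , u∈W′ }
      ; M-edges = λ { (m , u∈W′ , v∈W′) → u∈W′ , v∈W′ , proj₂ (proj₂ (M-edges m)) }
      ; covers  = covers′
      }
      where
      open PerfectMatching pm

      Mpq : M p q
      Mpq with v , m , _ ← covers p∈W with _ , v∈W , p~v ← M-edges m = subst (M p) (unique v∈W p~v) m

      covers′ : ∀ {u} → u ∈ W′ → ∃ λ v → (M u v × u ∈ W′ × v ∈ W′) × (∀ {w} → M u w × u ∈ W′ × w ∈ W′ → v ≡ w)
      covers′ {u} u∈W′ with rest⁻ u∈W′
      ... | u∈W , u≢p , u≢q with covers u∈W
      ...   | v , m , v-unique = v , (m , u∈W′ , rest⁺ v∈W v≢p v≢q) , v-unique ∘ proj₁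
        where
        v∈W : v ∈ W
        v∈W = proj₁ (proj₂ (M-edges m))

        v≢p : v ≢ p
        v≢p refl = p≁W′ u∈W′ (~-sym (proj₂ (proj₂ (M-edges m))))

        v≢q : v ≢ q
        v≢q refl with w , _ , w-unique ← covers q∈W = u≢p (trans (sym (w-unique (M-sym m))) (w-unique (M-sym Mpq)))

  -- Sequences of δ-transformations

  private
    _⇝_ = Star (δ-Transformation G)

  ⇝-⊆ : ∀ {W W′} → W ⇝ W′ → W′ ⊆ W
  ⇝-⊆ ε        = λ u∈ → u∈
  ⇝-⊆ (t ◅ ts) = proj₁ ∘ PendantPair.rest⁻ (pendantPair t) ∘ ⇝-⊆ ts

  ⇝-solvable⁺ : ∀ {W W′} → W ⇝ W′ → Solvable S W → Solvable S W′
  ⇝-solvable⁺ ε        sol = sol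
  ⇝-solvable⁺ (t ◅ ts) sol = ⇝-solvable⁺ ts (solvable-restrict (pendantPair t) sol)

  ⇝-solvable⁻ : ∀ {W W′} → W ⇝ W′ → Solvable S W′ → Solvable S W
  ⇝-solvable⁻ ε        sol = sol
  ⇝-solvable⁻ (t ◅ ts) sol = solvable-extend (pendantPair t) (⇝-solvable⁻ ts sol)

  -- Z = `⊥` gives matchings of the whole graph, Z = `vertexSet C` those of G - C. As Z lies in the
  -- final set, it meets no deleted pair.
  ⇝-perfectMatching⁺ : ∀ {W W′ Z} → W ⇝ W′ → Z ⊆ W′ → PerfectMatching G (W ∩ ∁ Z) → PerfectMatching G (W′ ∩ ∁ Z)
  ⇝-perfectMatching⁺ ε        Z⊆ pm = pm
  ⇝-perfectMatching⁺ (t ◅ ts) Z⊆ pm =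
    ⇝-perfectMatching⁺ ts Z⊆ (perfectMatching-restrict (pendantPair-∩ (⇝-⊆ ts ∘ Z⊆) (pendantPair t)) pm)

  ⇝-perfectMatching⁻ : ∀ {W W′ Z} → W ⇝ W′ → Z ⊆ W′ → PerfectMatching G (W′ ∩ ∁ Z) → PerfectMatching G (W ∩ ∁ Z)
  ⇝-perfectMatching⁻ ε        Z⊆ pm = pm
  ⇝-perfectMatching⁻ (t ◅ ts) Z⊆ pm =
    perfectMatching-extend (pendantPair-∩ (⇝-⊆ ts ∘ Z⊆) (pendantPair t)) (⇝-perfectMatching⁻ ts Z⊆ pm)

  perfectMatching-empty : ∀ {W} → (∀ {u} → u ∉ W) → PerfectMatching G W
  perfectMatching-empty empty = record
    { M = λ u _ → u ∈ ⊥ ; M-sym = λ u∈⊥ → contradiction u∈⊥ ∉⊥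
    ; M-edges = λ u∈⊥ → contradiction u∈⊥ ∉⊥ ; covers = λ u∈W → contradiction u∈W empty }

  NoPendant : Subset n → Set
  NoPendant W = ∀ {v} → v ∈ W → degree G W v ≢ 1

  -- Each transformation deletes at least its pendant vertex, so a bound on the size of W suffices
  -- as fuel.
  reduce : ∀ fuel W → ∣ W ∣ ℕ.≤ fuel → ∃ λ W′ → W ⇝ W′ × NoPendant W′
  reduce fuel W ∣W∣≤ with any? (λ v → (v ∈? W) ×-dec (degree G W v ℕ.≟ 1))
  ... | no none = W , ε , λ v∈W d≡1 → none (_ , v∈W , d≡1)
  reduce zero W ∣W∣≤ | yes (v , v∈W , _) = contradiction (ℕ.≤-trans (x∈p⇒∣p-x∣<∣p∣ v∈W) ∣W∣≤) λ ()
  reduce (suc fuel) W ∣W∣≤ | yes (v , v∈W , d≡1)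
    with q , q∈N ← ∣p∣≡1⇒nonempty d≡1
    with W′ , ts , stuck ← reduce fuel (W ∖ v ∖ q)
           (ℕ.≤-trans (∣p─q∣≤∣p∣ (W ∖ v) ⁅ q ⁆) (ℕ.≤-pred (ℕ.≤-trans (x∈p⇒∣p-x∣<∣p∣ v∈W) ∣W∣≤)))
    = W′ , record
      { pendant = v ; neighbour = q ; pendant∈W = v∈W ; degree≡1 = d≡1 ; neighbour∈ = q∈N ; result = refl }
      ◅ ts , stuck

-- Cycles and paths

module _ {n : ℕ} where
  open import Data.Vec.Membership.DecPropositional (_≟_ {n}) using () renaming (_∈?_ to _∈ᵛ?_) public

-- Indices modulo the length of a cycle

toℕ-mod : ∀ m k .{{_ : ℕ.NonZero k}} → toℕ (m mod k) ≡ m % k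
toℕ-mod m k = toℕ-fromℕ< (m%n<n m k)

mod-≡⁺ : ∀ m o {k} .{{_ : ℕ.NonZero k}} → m % k ≡ o % k → m mod k ≡ o mod k
mod-≡⁺ m o {k} eq = toℕ-injective (trans (toℕ-mod m k) (trans eq (sym (toℕ-mod o k))))

mod-≡⁻ : ∀ m o {k} .{{_ : ℕ.NonZero k}} → m mod k ≡ o mod k → m % k ≡ o % k
mod-≡⁻ m o {k} eq = trans (sym (toℕ-mod m k)) (trans (cong toℕ eq) (toℕ-mod o k))

suc[m%k]%k≡suc[m]%k : ∀ m k .{{_ : ℕ.NonZero k}} → suc (m % k) % k ≡ suc m % k
suc[m%k]%k≡suc[m]%k m k = trans (sym ([m+kn]%n≡m%n (suc (m % k)) (m / k) k))
  (cong (λ z → suc z % k) (sym (m≡m%n+[m/n]*n m k)))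

-- Adding k amounts to subtracting 1 modulo k + 1.
suc-%-cancel : ∀ m o k → suc m % suc k ≡ suc o % suc k → m % suc k ≡ o % suc k
suc-%-cancel m o k eq = trans (sym (shift m)) (trans (cong (λ z → (z ℕ.+ k % suc k) % suc k) eq) (shift o))
  where
  shift : ∀ m → (suc m % suc k ℕ.+ k % suc k) % suc k ≡ m % suc k
  shift m = trans (sym (%-distribˡ-+ (suc m) k (suc k)))
    (trans (cong (_% suc k) (sym (ℕ.+-suc m k))) ([m+n]%n≡m%n m (suc k)))

-- Otherwise k would divide 2. This separates the two neighbours of a vertex on a cycle.
%-skip : ∀ m k .{{_ : ℕ.NonZero k}} → 2 ℕ.< k → m % k ≢ suc (suc m) % k
%-skip m k 2<k eq = ℕ.<⇒≱ 2<k (∣⇒≤ k∣2)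
  where
  k∣2 : k ∣ 2
  k∣2 = ∣m+n∣m⇒∣n (divides (suc (suc m) / k) (ℕ.+-cancelˡ-≡ (m % k) _ _ (begin
    m % k ℕ.+ (m / k ℕ.* k ℕ.+ 2)          ≡⟨ cong (m % k ℕ.+_) (ℕ.+-comm (m / k ℕ.* k) 2) ⟩
    m % k ℕ.+ (2 ℕ.+ m / k ℕ.* k)          ≡⟨ ℕ.+-suc (m % k) (suc (m / k ℕ.* k)) ⟩
    suc (m % k ℕ.+ suc (m / k ℕ.* k))      ≡⟨ cong suc (ℕ.+-suc (m % k) (m / k ℕ.* k)) ⟩
    suc (suc (m % k ℕ.+ m / k ℕ.* k))      ≡⟨ cong (2 ℕ.+_) (m≡m%n+[m/n]*n m k) ⟨
    suc (suc m)                            ≡⟨ m≡m%n+[m/n]*n (suc (suc m)) k ⟩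
    suc (suc m) % k ℕ.+ suc (suc m) / k ℕ.* k ≡⟨ cong (ℕ._+ suc (suc m) / k ℕ.* k) eq ⟨
    m % k ℕ.+ suc (suc m) / k ℕ.* k        ∎))) (n∣m*n (m / k))

periodic-% : ∀ {f k} .{{_ : ℕ.NonZero k}} → Periodic k f → ∀ m → f (m % k) ≡ f m
periodic-% {f} {k} per m = trans (sym (go (m / k))) (cong f (sym (m≡m%n+[m/n]*n m k)))
  where
  go : ∀ j → f (m % k ℕ.+ j ℕ.* k) ≡ f (m % k)
  go zero    = cong f (ℕ.+-identityʳ (m % k))
  go (suc j) = trans (cong f (trans (cong (m % k ℕ.+_) (ℕ.+-comm k (j ℕ.* k))) (sym (ℕ.+-assoc (m % k) (j ℕ.* k) k))))
                     (trans (per (m % k ℕ.+ j ℕ.* k)) (go j))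

-- Simple paths. The vertices are kept in an indexing vector so that `lookup` can serve directly as
-- the vertex map of a `Cycle`.
data Path {n} (R : Rel (Fin n) 0ℓ) : ∀ {k} → Fin n → Fin n → Vec (Fin n) (suc k) → Set where
  stop : ∀ {x} → Path R x x (x ∷ [])
  step : ∀ {k x y z} {xs : Vec _ (suc k)} → R x y → Path R y z xs → x ∉ᵛ xs → Path R x z (x ∷ xs)

module _ {n} {R : Rel (Fin n) 0ℓ} where

  path-head : ∀ {k x y} {xs : Vec _ (suc k)} → Path R x y xs → lookup xs zero ≡ x
  path-head stop         = refl
  path-head (step _ _ _) = refl

  start∈path : ∀ {k x y} {xs : Vec _ (suc k)} → Path R x y xs → x ∈ᵛ xs
  start∈path stop         = here refl
  start∈path (step _ _ _) = here refl

  path-last : ∀ {k x y} {xs : Vec _ (suc k)} → Path R x y xs → ∀ i → toℕ i ≡ k → lookup xs i ≡ y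
  path-last stop         zero    _  = refl
  path-last (step _ π _) (suc i) eq = path-last π i (ℕ.suc-injective eq)

  path-consecutive : ∀ {k x y} {xs : Vec _ (suc k)} → Path R x y xs →
    ∀ i j → toℕ j ≡ suc (toℕ i) → R (lookup xs i) (lookup xs j)
  path-consecutive stop         _       zero    ()
  path-consecutive stop         _       (suc ()) _
  path-consecutive (step r π _) zero    (suc zero)    refl = subst (R _) (sym (path-head π)) r
  path-consecutive (step r π _) (suc i) (suc j) eq   = path-consecutive π i j (ℕ.suc-injective eq)

  path-injective : ∀ {k x y} {xs : Vec _ (suc k)} → Path R x y xs → ∀ {i j} → lookup xs i ≡ lookup xs j → i ≡ j
  path-injective stop           {zero}  {zero}  _  = refl
  path-injective (step _ _ _)   {zero}  {zero}  _  = refl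
  path-injective (step _ _ x∉)  {zero}  {suc j} eq = contradiction (subst (_∈ᵛ _) (sym eq) (∈-lookup j _)) x∉
  path-injective (step _ _ x∉)  {suc i} {zero}  eq = contradiction (subst (_∈ᵛ _) eq (∈-lookup i _)) x∉
  path-injective (step _ π _)   {suc i} {suc j} eq = cong suc (path-injective π eq)

  takeTo : ∀ {k x y z} {xs : Vec _ (suc k)} → Path R x z xs → y ∈ᵛ xs →
    ∃ λ l → Σ (Vec (Fin n) (suc l)) λ ys → Path R x y ys × (∀ {w} → w ∈ᵛ ys → w ∈ᵛ xs)
  takeTo stop          (here refl) = _ , _ , stop , λ w∈ → w∈
  takeTo (step _ _ _)  (here refl) = _ , _ , stop , λ { (here refl) → here refl }
  takeTo (step r π x∉) (there y∈) with _ , _ , π′ , sub ← takeTo π y∈ =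
    _ , _ , step r π′ (x∉ ∘ sub) , λ { (here refl) → here refl ; (there w∈) → there (sub w∈) }

  dropTo : ∀ {k x y z} {xs : Vec _ (suc k)} → Path R x z xs → y ∈ᵛ xs →
    ∃ λ l → Σ (Vec (Fin n) (suc l)) λ ys → Path R y z ys
  dropTo stop            (here refl) = _ , _ , stop
  dropTo π@(step _ _ _)  (here refl) = _ , _ , π
  dropTo (step _ π _)    (there y∈)  = dropTo π y∈

  -- If the new first vertex already occurs on the simple path built so far, the path is restarted
  -- from that occurrence.
  loopErase : ∀ {x y} → Star R x y → ∃ λ l → Σ (Vec (Fin n) (suc l)) λ xs → Path R x y xs
  loopErase ε = _ , _ , stop
  loopErase {x} (r ◅ rs) with _ , xs , π ← loopErase rs with x ∈ᵛ? xs
  ... | yes x∈ = dropTo π x∈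
  ... | no x∉  = _ , _ , step r π x∉

mapPath : ∀ {n} {R T : Rel (Fin n) 0ℓ} → (∀ {x y} → R x y → T x y) →
  ∀ {k x y} {xs : Vec _ (suc k)} → Path R x y xs → Path T x y xs
mapPath f stop          = stop
mapPath f (step r π x∉) = step (f r) (mapPath f π) x∉

module _ {n} (G : OrientedGraph n) where
  open OrientedGraph G
  open Cycle

  private
    S = skewAdjacency

  -- A cycle as a periodic sequence of vertices

  module _ (C : Cycle G) where
    private
      k = length C

    at : ℕ → Fin n
    at m = vertex C (m mod k)

    at-cong : ∀ m o → m % k ≡ o % k → at m ≡ at o
    at-cong m o eq = cong (vertex C) (mod-≡⁺ m o eq)

    at-injective : ∀ m o → at m ≡ at o → m % k ≡ o % k
    at-injective m o eq = mod-≡⁻ m o (injective C eq)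

    at-toℕ : ∀ i → at (toℕ i) ≡ vertex C i
    at-toℕ i = cong (vertex C) (toℕ-injective (trans (toℕ-mod (toℕ i) k) (m<n⇒m%n≡m (toℕ<n i))))

    next-at : ∀ m → vertex C (next C (m mod k)) ≡ at (suc m)
    next-at m = at-cong (suc (toℕ (m mod k))) (suc m)
      (trans (cong (λ z → suc z % k) (toℕ-mod m k)) (suc[m%k]%k≡suc[m]%k m k))

    at-period : ∀ m → at (m ℕ.+ k) ≡ at m
    at-period m = at-cong (m ℕ.+ k) m ([m+n]%n≡m%n m k)

    at-adjacent : ∀ m → at m ~ at (suc m)
    at-adjacent m = subst (at m ~_) (next-at m) (adjacent C (m mod k))

    at-skip : ∀ m → at (suc (suc m)) ≢ at m
    at-skip m eq = %-skip m k (s≤s (s≤s (s≤s ℕ.z≤n))) (sym (at-injective (suc (suc m)) m eq))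

    at-Edge : ∀ m → Edge C (at m) (at (suc m))
    at-Edge m = m mod k , inj₁ (refl , sym (next-at m))

    Edge-at : ∀ {m u} → Edge C (at (suc m)) u → u ≡ at (suc (suc m)) ⊎ u ≡ at m
    Edge-at {m} (i , inj₁ (at≡ , u≡)) =
      inj₁ (trans u≡ (trans (cong (vertex C ∘ next C) (sym (injective C at≡))) (next-at (suc m))))
    Edge-at {m} (i , inj₂ (u≡ , at≡)) =
      inj₂ (trans u≡ (trans (sym (at-toℕ i)) (at-cong (toℕ i) m
        (suc-%-cancel (toℕ i) m (2 ℕ.+ extra C) (at-injective (suc (toℕ i)) (suc m) (sym at≡))))))

    Edge-sym : ∀ {u v} → Edge C u v → Edge C v u
    Edge-sym (i , e) = i , swap e

    Edge? : ∀ u v → Dec (Edge C u v)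
    Edge? u v = any? λ i → ((u ≟ vertex C i) ×-dec (v ≟ vertex C (next C i)))
                     ⊎-dec ((v ≟ vertex C i) ×-dec (u ≟ vertex C (next C i)))

    ∈-vertexSet⁺ : ∀ i → vertex C i ∈ vertexSet C
    ∈-vertexSet⁺ i = ∈-tabulate⁺ (λ v → any? (λ i → vertex C i ≟ v)) (i , refl)

    ∈-vertexSet⁻ : ∀ {v} → v ∈ vertexSet C → ∃ λ i → vertex C i ≡ v
    ∈-vertexSet⁻ = ∈-tabulate⁻ (λ v → any? (λ i → vertex C i ≟ v))

    -- Rows are evaluated at `at (suc m)`, where both cycle neighbours have natural indices. Adding
    -- k - 1 = 2 + `extra C` to i makes the successor one full turn past i.
    ∈-vertexSet-suc : ∀ {v} → v ∈ vertexSet C → ∃ λ m → v ≡ at (suc m)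
    ∈-vertexSet-suc v∈ with i , refl ← ∈-vertexSet⁻ v∈ = toℕ i ℕ.+ (2 ℕ.+ extra C) ,
      trans (sym (at-toℕ i)) (trans (sym (at-period (toℕ i))) (cong at (ℕ.+-suc (toℕ i) _)))

    Edge⇒∈ : ∀ {u v} → Edge C u v → u ∈ vertexSet C
    Edge⇒∈ (i , inj₁ (refl , _)) = ∈-vertexSet⁺ i
    Edge⇒∈ (i , inj₂ (_ , refl)) = ∈-vertexSet⁺ (next C i)

    sign : ℕ → ℚ
    sign m = S (at m) (at (suc m))

    sign-isSign : ∀ m → IsSign (sign m)
    sign-isSign m = skewAdjacency-edge G (at-adjacent m)

    sign-period : Periodic k sign
    sign-period m = cong₂ S (at-period m) (at-period (suc m))

    product≡prod-sign : product (λ i → S (vertex C i) (vertex C (next C i))) ≡ prod sign k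
    product≡prod-sign = trans (product-cong λ i → cong (λ v → S v (vertex C (next C i))) (sym (at-toℕ i)))
                              (product-toℕ sign k)

    onCycle : (ℕ → ℚ) → Fin n → ℚ
    onCycle X v with any? (λ i → vertex C i ≟ v)
    ... | yes (i , _) = X (toℕ i)
    ... | no _        = 0ℚ

    onCycle-at : ∀ {X} → Periodic k X → ∀ m → onCycle X (at m) ≡ X m
    onCycle-at {X} per m with any? (λ i → vertex C i ≟ at m)
    ... | yes (i , eq) = trans (cong X (trans (cong toℕ (injective C eq)) (toℕ-mod m k))) (periodic-% {X} per m)
    ... | no none      = contradiction (m mod k , refl) none

    onCycle-off : ∀ {X v} → v ∉ vertexSet C → onCycle X v ≡ 0ℚ
    onCycle-off {v = v} v∉ with any? (λ i → vertex C i ≟ v)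
    ... | yes (i , refl) = contradiction (∈-vertexSet⁺ i) v∉
    ... | no _           = refl

    module _ (chordless : ∀ {u v} → u ∈ vertexSet C → v ∈ vertexSet C → u ~ v → Edge C u v) where

      -- Without chords only the two cycle neighbours contribute to the row, and they are distinct
      -- because the length is at least 3.
      cycle-row : ∀ {x} → (∀ v → v ∉ vertexSet C → x v ≡ 0ℚ) → ∀ m → (S ∙ x) (at (suc m)) ≡ cyclic sign (x ∘ at) m
      cycle-row {x} x-off m = trans (sum-pair _ (at-skip m) vanish)
        (cong (λ s → sign (suc m) * x (at (suc (suc m))) + s * x (at m)) (skewAdjacency-skew G (at m) (at (suc m))))
        where
        vanish : ∀ v → v ≢ at (suc (suc m)) → v ≢ at m → S (at (suc m)) v * x v ≡ 0ℚ
        vanish v v≢₁ v≢₂ with v ∈? vertexSet C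
        ... | no v∉  = trans (cong (S (at (suc m)) v *_) (x-off v v∉)) (*-zeroʳ (S (at (suc m)) v))
        ... | yes v∈ = trans (cong (_* x v) (skewAdjacency-nonEdge G nonEdge)) (*-zeroˡ (x v))
          where
          nonEdge : ¬ at (suc m) ~ v
          nonEdge e with Edge-at {m} (chordless (∈-vertexSet⁺ (suc m mod k)) v∈ e)
          ... | inj₁ eq = v≢₁ eq
          ... | inj₂ eq = v≢₂ eq

      onCycle-row : ∀ {X} → Periodic k X → ∀ m → (S ∙ onCycle X) (at (suc m)) ≡ cyclic sign X m
      onCycle-row {X} per m = trans (cycle-row {onCycle X} (λ _ → onCycle-off {X}) m)
        (cong₂ (λ a b → sign (suc m) * a + - (sign m) * b) (onCycle-at {X} per (suc (suc m))) (onCycle-at {X} per m))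

      -- If the product were 1, the partial products would be periodic and hence define a kernel
      -- vector on the cycle; its entry at index 0 is the empty product 1.
      solvable⇒prod≢1 : Solvable S (vertexSet C) → ∀ {c} → IsSign c → prod (λ i → c * sign i) k ≢ 1ℚ
      solvable⇒prod≢1 sol {c} c-sign prod≡1 = 1≢0 (trans (sym (onCycle-at {X} X-per 0))
        (solvable⇒kernel-trivial (skewAdjacency-skew G) sol (onCycle X) (λ _ → onCycle-off {X}) kernel (at 0)))
        where
        X : ℕ → ℚ
        X = prod (λ i → c * sign i)

        X-per : Periodic k X
        X-per m = trans (prod-period {λ i → c * sign i} (λ j → cong (c *_) (sign-period j)) m)
          (trans (cong (X m *_) prod≡1) (*-identityʳ (X m)))

        kernel : ∀ v → v ∈ vertexSet C → (S ∙ onCycle X) v ≡ 0ℚ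
        kernel v v∈ with m , refl ← ∈-vertexSet-suc v∈ =
          trans (onCycle-row {X} X-per m) (cyclic-kernel {sign} sign-isSign c-sign m)

      solvable⇒oddlyOriented : Solvable S (vertexSet C) → OddlyOriented C
      solvable⇒oddlyOriented sol with prod-sign {sign} sign-isSign k | prod-neg sign k
      ... | inj₁ P≡1  | _ = contradiction (trans (prod-cong (λ i → *-identityˡ (sign i)) k) P≡1)
                                          (solvable⇒prod≢1 sol (inj₁ refl))
      ... | inj₂ P≡-1 | inj₂ eq = contradiction (trans eq (cong -_ P≡-1)) (solvable⇒prod≢1 sol (inj₂ refl))
      ... | inj₂ P≡-1 | inj₁ 2∣k = 2∣k , subst (_< 0ℚ) (sym (trans product≡prod-sign P≡-1)) (from-yes (- 1ℚ <? 0ℚ))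

      oddlyOriented⇒prod≡-1 : OddlyOriented C → prod sign k ≡ - 1ℚ
      oddlyOriented⇒prod≡-1 (_ , P<0) = go (prod-sign {sign} sign-isSign k) (subst (_< 0ℚ) product≡prod-sign P<0)
        where
        go : ∀ {P} → IsSign P → P < 0ℚ → P ≡ - 1ℚ
        go (inj₁ refl) 1<0 = contradiction 1<0 (from-no (1ℚ <? 0ℚ))
        go (inj₂ eq)   _   = eq

      oddlyOriented⇒solvable : OddlyOriented C → Solvable S (vertexSet C)
      oddlyOriented⇒solvable odd@(divides h k≡h*2 , _) b = fromSequence solution
        where
        Solution : ℕ → Set
        Solution l = Σ (ℕ → ℚ) λ X → Periodic l X × (∀ m → cyclic sign X m ≡ b (at (suc m)))

        -- The length 3 + `extra C` does not unify with h * 2, so the equation is matched at a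
        -- variable l.
        solve-cyclic : ∀ {l} → l ≡ h ℕ.* 2 → Periodic l sign → prod sign l ≡ - 1ℚ → Periodic l (b ∘ at) → Solution l
        solve-cyclic refl = λ s-per P≡-1 b-per → cyclic-solution {sign} {h} sign-isSign s-per P≡-1 {b ∘ at} b-per

        solution : Solution k
        solution = solve-cyclic k≡h*2 sign-period (oddlyOriented⇒prod≡-1 odd) (λ m → cong b (at-period m))

        fromSequence : Solution k → Σ (Fin n → ℚ) λ x →
          (∀ v → v ∉ vertexSet C → x v ≡ 0ℚ) × (∀ v → v ∈ vertexSet C → (S ∙ x) v ≡ b v)
        fromSequence (X , X-per , X-solves) = onCycle X , (λ _ → onCycle-off {X}) , hit
          where
          hit : ∀ v → v ∈ vertexSet C → (S ∙ onCycle X) v ≡ b v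
          hit v v∈ = let m , v≡ = ∈-vertexSet-suc v∈ in
            trans (cong (S ∙ onCycle X) v≡) (trans (onCycle-row {X} X-per m) (trans (X-solves m) (cong b (sym v≡))))

  -- From paths and walks to cycles

  module _ {l x y} {xs : Vec (Fin n) (3 ℕ.+ l)} (π : Path _~_ x y xs) (y~x : y ~ x) where
    private
      k = 3 ℕ.+ l

    pathCycle : Cycle G
    pathCycle = record { extra = l ; vertex = lookup xs ; injective = path-injective π ; adjacent = adj }
      where
      adj : ∀ i → lookup xs i ~ lookup xs (suc (toℕ i) mod k)
      adj i with suc (toℕ i) ℕ.≟ k
      ... | no ≢k  = path-consecutive π i _ (trans (toℕ-mod (suc (toℕ i)) k) (m<n⇒m%n≡m (ℕ.≤∧≢⇒< (toℕ<n i) ≢k)))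
      ... | yes ≡k = subst₂ _~_ (sym (path-last π i (ℕ.suc-injective ≡k)))
                                (sym (trans (cong (lookup xs) wrap) (path-head π))) y~x
        where
        wrap : suc (toℕ i) mod k ≡ zero
        wrap = toℕ-injective (trans (toℕ-mod (suc (toℕ i)) k) (trans (cong (_% k) ≡k) (n%n≡0 k)))

    pathCycle-closes : Edge pathCycle y x
    pathCycle-closes = last , inj₁ (sym (path-last π last last≡) , sym (trans (cong (lookup xs) wrap) (path-head π)))
      where
      last = fromℕ (2 ℕ.+ l)
      last≡ : toℕ last ≡ 2 ℕ.+ l
      last≡ = toℕ-fromℕ (2 ℕ.+ l)
      wrap : suc (toℕ last) mod k ≡ zero
      wrap = toℕ-injective (trans (toℕ-mod (suc (toℕ last)) k) (trans (cong (λ z → suc z % k) last≡) (n%n≡0 k)))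

  -- The edge relation of G - uv.
  Avoiding : Fin n → Fin n → Fin n → Fin n → Set
  Avoiding u v a b = a ~ b × ¬ (a ≡ u × b ≡ v) × ¬ (a ≡ v × b ≡ u)

  avoiding-sym : ∀ {u v a b} → Avoiding u v a b → Avoiding u v b a
  avoiding-sym (a~b , ≢₁ , ≢₂) = ~-sym G a~b , (λ { (p , q) → ≢₂ (q , p) }) , λ { (p , q) → ≢₁ (q , p) }

  avoiding-swap : ∀ {u v a b} → Avoiding u v a b → Avoiding v u a b
  avoiding-swap (a~b , ≢₁ , ≢₂) = a~b , ≢₂ , ≢₁

  -- After loop erasure, no edge would mean a loop at u and one edge would be uv itself, so at least
  -- two edges remain and uv closes them to a cycle.
  avoiding-cycle : ∀ {u v} → u ~ v → Star (Avoiding u v) v u → Σ (Cycle G) λ D → Edge D u v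
  avoiding-cycle u~v walk with loopErase walk
  ... | _ , _ , stop                             = contradiction u~v (~-irrefl G)
  ... | _ , _ , step (_ , _ , ≢₂) stop _         = contradiction (refl , refl) ≢₂
  ... | _ , _ , π@(step _ (step _ _ _) _) = pathCycle π′ u~v , pathCycle-closes π′ u~v
    where π′ = mapPath proj₁ π

  -- A simple path in G[W] is prolonged until it closes up; since no vertex of W
  -- has degree 1, its end h always has a neighbour other than its predecessor p.
  grow : ∀ {W} → NoPendant G W → ∀ {u v} fuel {l h p z} {xs : Vec (Fin n) (suc l)} →
    Path _~_ p z xs → h ~ p → h ∉ᵛ xs → (∀ {w} → w ∈ᵛ h ∷ xs → w ∈ W) →
    u ∈ᵛ h ∷ xs → v ∈ᵛ h ∷ xs → Star (Avoiding u v) v h → n ℕ.< fuel ℕ.+ (2 ℕ.+ l) →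
    Σ (Cycle G) λ D → (∀ i → vertex D i ∈ W) × ∃ λ i → Star (Avoiding u v) v (vertex D i)
  -- The path has 2 + l distinct vertices, so by the bound it would exceed n when the fuel is spent.
  grow noPendant zero π h~p h∉ ⊆W u∈ v∈ walk n< =
    contradiction (injective⇒≤ (path-injective (step h~p π h∉))) (ℕ.<⇒≱ n<)
  grow {W} noPendant {u} {v} (suc fuel) {l} {h} {p} {xs = xs} π h~p h∉ ⊆W u∈ v∈ walk n<
    with y , y∈N , y≢p ← ∣p∣≢1⇒another (noPendant (⊆W (here refl))) (∈-neighbours⁺ G (⊆W (there (start∈path π))) h~p)
    with y∈W , h~y ← ∈-neighbours⁻ G y∈N
    with y ∈ᵛ? (h ∷ xs)
  ... | yes (here refl) = contradiction h~y (~-irrefl G)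
  ... | yes (there y∈)  = close π h∉ ⊆W y∈
    where
    -- Since y differs from h and p, the stretch from h to y has at least three vertices. The cycle
    -- starts at h, where `walk` ends, hence the index `zero`.
    close : ∀ {k z} {xs : Vec _ (suc k)} → Path _~_ p z xs → h ∉ᵛ xs → (∀ {w} → w ∈ᵛ h ∷ xs → w ∈ W) → y ∈ᵛ xs →
      Σ (Cycle G) λ D → (∀ i → vertex D i ∈ W) × ∃ λ i → Star (Avoiding u v) v (vertex D i)
    close stop          _  _  (here y≡p)  = contradiction y≡p y≢p
    close (step _ _ _)  _  _  (here y≡p)  = contradiction y≡p y≢p
    close (step p~q π p∉) h∉ ⊆W (there y∈) with _ , ys , π′ , sub ← takeTo π y∈ =
      pathCycle (step h~p (step p~q π′ (p∉ ∘ sub)) h∉′) (~-sym G h~y)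
      , (λ i → ⊆W (lift (∈-lookup i (h ∷ p ∷ ys)))) , zero , walk
      where
      h∉′ : h ∉ᵛ p ∷ ys
      h∉′ (here refl) = h∉ (here refl)
      h∉′ (there h∈)  = h∉ (there (sub h∈))
      lift : ∀ {w} → w ∈ᵛ h ∷ p ∷ ys → w ∈ᵛ h ∷ p ∷ _
      lift (here eq)          = here eq
      lift (there (here eq))  = there (here eq)
      lift (there (there w∈)) = there (there (sub w∈))
  -- Both u and v are already on the path and y is not, so the edge from h to y is not uv and
  -- extends `walk`.
  ... | no y∉ = grow noPendant fuel (step h~p π h∉) (~-sym G h~y) y∉ (λ { (here refl) → y∈W ; (there w∈) → ⊆W w∈ })
                  (there u∈) (there v∈) (walk ◅◅ (h~y , (λ { (_ , refl) → y∉ v∈ }) , λ { (_ , refl) → y∉ u∈ }) ◅ ε)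
                  (subst (n ℕ.<_) (sym (ℕ.+-suc fuel (2 ℕ.+ l))) n<)

  -- The initial path has head v and predecessor u, so growth leaves v by an edge other than uv, and
  -- the walk from v to the head is empty.
  grow-edge : ∀ {W} → NoPendant G W → ∀ {u v} → u ∈ W → v ∈ W → u ~ v →
    Σ (Cycle G) λ D → (∀ i → vertex D i ∈ W) × ∃ λ i → Star (Avoiding u v) v (vertex D i)
  grow-edge noPendant u∈W v∈W u~v =
    grow noPendant n stop (~-sym G u~v) (λ { (here refl) → ~-irrefl G u~v })
      (λ { (here refl) → v∈W ; (there (here refl)) → u∈W }) (there (here refl)) (here refl) ε
      (ℕ.m<m+n n (s≤s ℕ.z≤n))

  -- Consequences of the uniqueness of the cycle

  module _ (C : Cycle G) (C-unique : ∀ D → SameCycle G C D) where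

    sameVertices : ∀ D i → ∃ λ j → vertex C j ≡ vertex D i
    sameVertices D i with Equivalence.from (C-unique D _ _) (i , inj₁ (refl , refl))
    ... | j , inj₁ (eq , _) = j , sym eq
    ... | j , inj₂ (_ , eq) = next C j , sym eq

    avoiding-along : ∀ {u v} → ¬ Edge C u v → ∀ i j → Star (Avoiding u v) (vertex C i) (vertex C j)
    avoiding-along {u} {v} ¬e i j = subst₂ (Star _) (at-toℕ C i) (at-toℕ C j)
      (reverse avoiding-sym (from0 (toℕ i)) ◅◅ from0 (toℕ j))
      where
      from0 : ∀ m → Star (Avoiding u v) (at C 0) (at C m)
      from0 zero    = ε
      from0 (suc m) = from0 m ◅◅ (at-adjacent C m
        , (λ { (refl , refl) → ¬e (at-Edge C m) }) , (λ { (refl , refl) → ¬e (Edge-sym C (at-Edge C m)) })) ◅ ε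

    -- If uv lay off C, walks from v and from u would both reach C without using uv,
    -- and joining them along C gives a cycle through uv.
    noPendant⇒Edge : ∀ {W} → NoPendant G W → ∀ {u v} → u ∈ W → v ∈ W → u ~ v → Edge C u v
    noPendant⇒Edge noPendant {u} {v} u∈W v∈W u~v with Edge? C u v
    ... | yes e = e
    ... | no ¬e
      with D , _ , i , walk ← grow-edge noPendant u∈W v∈W u~v
         | D′ , _ , i′ , walk′ ← grow-edge noPendant v∈W u∈W (~-sym G u~v)
      with j , refl-j ← sameVertices D i | j′ , refl-j′ ← sameVertices D′ i′
      with E , e ← avoiding-cycle u~v (walk ◅◅ subst₂ (Star _) refl-j refl-j′ (avoiding-along ¬e j j′)
                     ◅◅ reverse avoiding-sym (Star.map avoiding-swap walk′))
      = Equivalence.from (C-unique E u v) e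

    vertexSet-same : ∀ D → vertexSet D ⊆ vertexSet C
    vertexSet-same D v∈ with i , refl ← ∈-vertexSet⁻ D v∈ with j , eq ← sameVertices D i =
      subst (_∈ vertexSet C) eq (∈-vertexSet⁺ C j)

  -- `SameCycle` compares only edges, so the lengths are compared by injecting the vertices of C
  -- into those of D.
  sameCycle-length : ∀ {C D} → (∀ D′ → SameCycle G D D′) → length C ℕ.≤ length D
  sameCycle-length {C} {D} D-unique = injective⇒≤ {f = λ i → proj₁ (sameVertices D D-unique C i)} λ {i} {j} eq →
    injective C (trans (sym (proj₂ (sameVertices D D-unique C i)))
                (trans (cong (vertex D) eq) (proj₂ (sameVertices D D-unique C j))))

-- Unicyclic graphs

open OrientedGraph using (Connected; skewAdjacency)
open Cycle using (length; vertexSet; OddlyOriented)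

∩-∁⊥ : ∀ {n} (W : Subset n) → W ∩ ∁ ⊥ ≡ W
∩-∁⊥ W = ⊆-antisym (p∩q⊆p W (∁ ⊥)) λ x∈W → x∈p∩q⁺ (x∈W , x∉p⇒x∈∁p ∉⊥)

module _ {n} (G : OrientedGraph n) where
  open OrientedGraph G using (_~_; _~?_)

  private
    S = skewAdjacency G

  -- Lets any cycle replace the one stored in `Unicyclic` as the reference for uniqueness.
  sameCycle-euclidean : ∀ C D E → SameCycle G C D → SameCycle G C E → SameCycle G D E
  sameCycle-euclidean _ _ _ CD CE u v = ⇔-trans (⇔-sym (CD u v)) (CE u v)

  solvable⇒no-isolated : ∀ {W} → Solvable S W → ∀ {u} → u ∈ W → ¬ (∀ {v} → v ∈ W → ¬ v ~ u)
  solvable⇒no-isolated sol u∈W isolated = solvable⇒no-zero-row (skewAdjacency-skew G) sol u∈W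
    λ v v∈W → skewAdjacency-nonEdge G (isolated v∈W)

  solvable-empty : ∀ {W} → (∀ {u} → u ∉ W) → Solvable S W
  solvable-empty empty b = (λ _ → 0ℚ) , (λ _ _ → refl) , λ _ u∈W → contradiction u∈W empty

  module _ (C : Cycle G) (C-unique : ∀ D → SameCycle G C D) where

    length-girth : Girth G (length C)
    length-girth = (C , refl) , λ D →
      sameCycle-length G {C} {D} λ E → sameCycle-euclidean C D E (C-unique D) (C-unique E)

    cycle⊆ : ∀ D → vertexSet C ⊆ vertexSet D
    cycle⊆ D = vertexSet-same G D (λ E → sameCycle-euclidean C D E (C-unique D) (C-unique E)) C

    module _ {W} (ts : TransformsTo G W) (solW : Solvable S W) where

      -- Solvability excludes isolated vertices, so W is empty: every vertex was deleted in some
      -- pendant pair, and these pairs are the matching.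
      edgeless⇒matching : Edgeless G W → PerfectMatching G ⊤
      edgeless⇒matching edgeless = subst (PerfectMatching G) (∩-∁⊥ ⊤)
        (⇝-perfectMatching⁻ G ts ⊥⊆ (perfectMatching-empty G (W-empty ∘ proj₁ ∘ x∈p∩q⁻ W (∁ ⊥))))
        where
        W-empty : ∀ {u} → u ∉ W
        W-empty u∈W = solvable⇒no-isolated solW u∈W λ v∈W v~u → edgeless v∈W u∈W v~u

      module _ (C⊆W : vertexSet C ⊆ W) (edges : ∀ {u v} → u ∈ W → v ∈ W → u ~ v → Cycle.Edge C u v) where

        ⊆cycle : W ⊆ vertexSet C
        ⊆cycle {u} u∈W with u ∈? vertexSet C
        ... | yes u∈C = u∈C
        ... | no u∉C  = ⊥-elim (solvable⇒no-isolated solW u∈W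
                          λ v∈W v~u → u∉C (Edge⇒∈ G C (Edge-sym G C (edges v∈W u∈W v~u))))

        cycle⇒odd : OddlyOriented C
        cycle⇒odd = solvable⇒oddlyOriented G C (λ u∈C v∈C → edges (C⊆W u∈C) (C⊆W v∈C))
                      (subst (Solvable S) (⊆-antisym ⊆cycle C⊆W) solW)

        cycle⇒matching : PerfectMatching G (∁ (vertexSet C))
        cycle⇒matching = subst (PerfectMatching G) (∩-identityˡ (∁ (vertexSet C)))
          (⇝-perfectMatching⁻ G ts C⊆W (perfectMatching-empty G empty))
          where
          empty : ∀ {u} → u ∉ W ∩ ∁ (vertexSet C)
          empty u∈ = let u∈W , u∈∁C = x∈p∩q⁻ W (∁ (vertexSet C)) u∈ in x∈∁p⇒x∉p u∈∁C (⊆cycle u∈W)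

    -- Growing a path from the edge produces a cycle inside W, and by uniqueness it passes through
    -- all vertices of C.
    noPendant⇒cycle⊆ : ∀ {W} → NoPendant G W → ∀ {u v} → u ∈ W → v ∈ W → u ~ v → vertexSet C ⊆ W
    noPendant⇒cycle⊆ {W} noPendant u∈W v∈W u~v w∈C =
      let D , D⊆W , _ = grow-edge G noPendant u∈W v∈W u~v
          i , i≡ = ∈-vertexSet⁻ G D (cycle⊆ D w∈C)
      in subst (_∈ W) i≡ (D⊆W i)

    nonsingular⇒matchings : Nonsingular S → Unicyclic G →
      (𝒰₁ G (length C) × PerfectMatching G ⊤) ⊎
      (𝒰₂ G (length C) × OddlyOriented C × PerfectMatching G (∁ (vertexSet C)))
    nonsingular⇒matchings nonsingular unicyclic =
      let W , ts , noPendant = reduce G ∣ ⊤ {n} ∣ ⊤ ℕ.≤-refl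
      in terminal ts noPendant (any? λ u → any? λ v → (u ∈? W) ×-dec (v ∈? W) ×-dec (u ~? v))
      where
      terminal : ∀ {W} → TransformsTo G W → NoPendant G W → Dec (∃₂ λ u v → u ∈ W × v ∈ W × u ~ v) →
        (𝒰₁ G (length C) × PerfectMatching G ⊤) ⊎
        (𝒰₂ G (length C) × OddlyOriented C × PerfectMatching G (∁ (vertexSet C)))
      terminal {W} ts noPendant (no noEdge) =
        inj₁ ((unicyclic , length-girth , W , ts , edgeless) , edgeless⇒matching ts solW edgeless)
        where
        solW : Solvable S W
        solW = ⇝-solvable⁺ G ts (nonsingular⇒solvable nonsingular)
        edgeless : Edgeless G W
        edgeless u∈W v∈W u~v = noEdge (_ , _ , u∈W , v∈W , u~v)
      terminal {W} ts noPendant (yes (_ , _ , u∈W , v∈W , u~v)) =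
        inj₂ ((unicyclic , length-girth , C , W , ts , C⊆W , edges)
             , cycle⇒odd ts solW C⊆W edges , cycle⇒matching ts solW C⊆W edges)
        where
        solW : Solvable S W
        solW = ⇝-solvable⁺ G ts (nonsingular⇒solvable nonsingular)
        C⊆W : vertexSet C ⊆ W
        C⊆W = noPendant⇒cycle⊆ noPendant u∈W v∈W u~v
        edges : ∀ {u v} → u ∈ W → v ∈ W → u ~ v → Cycle.Edge C u v
        edges = noPendant⇒Edge G C C-unique noPendant

    -- The matching descends to W, where a covered vertex would need an edge; hence W is empty and
    -- its system trivially solvable.
    𝒰₁-matching⇒nonsingular : ∀ {k} → 𝒰₁ G k → PerfectMatching G ⊤ → Nonsingular S
    𝒰₁-matching⇒nonsingular (_ , _ , W , ts , edgeless) pm =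
      solvable⇒nonsingular (skewAdjacency-skew G) (⇝-solvable⁻ G ts (solvable-empty W-empty))
      where
      pm-W : PerfectMatching G W
      pm-W = subst (PerfectMatching G) (∩-∁⊥ W)
        (⇝-perfectMatching⁺ G ts ⊥⊆ (subst (PerfectMatching G) (sym (∩-∁⊥ ⊤)) pm))
      W-empty : ∀ {u} → u ∉ W
      W-empty u∈W
        with v , m , _ ← PerfectMatching.covers pm-W u∈W
        with _ , v∈W , u~v ← PerfectMatching.M-edges pm-W m
        = edgeless u∈W v∈W u~v

    -- The membership brings its own cycle D, which uniqueness identifies with C. A vertex of W off
    -- C would be matched along an edge of G[W], yet all such edges lie on C; so W is exactly the
    -- vertex set of C.
    𝒰₂-matching⇒nonsingular : ∀ {k} → 𝒰₂ G k → OddlyOriented C → PerfectMatching G (∁ (vertexSet C)) → Nonsingular S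
    𝒰₂-matching⇒nonsingular (_ , _ , D , W , ts , D⊆W , edges) odd pm =
      solvable⇒nonsingular (skewAdjacency-skew G) (⇝-solvable⁻ G ts (subst (Solvable S) (⊆-antisym C⊆W W⊆C)
        (oddlyOriented⇒solvable G C (λ u∈C v∈C → edgesC (C⊆W u∈C) (C⊆W v∈C)) odd)))
      where
      edgesC : ∀ {u v} → u ∈ W → v ∈ W → u ~ v → Cycle.Edge C u v
      edgesC u∈W v∈W u~v = Equivalence.from (C-unique D _ _) (edges u∈W v∈W u~v)
      C⊆W : vertexSet C ⊆ W
      C⊆W = D⊆W ∘ cycle⊆ D
      pm-W : PerfectMatching G (W ∩ ∁ (vertexSet C))
      pm-W = ⇝-perfectMatching⁺ G ts C⊆W (subst (PerfectMatching G) (sym (∩-identityˡ (∁ (vertexSet C)))) pm)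
      W⊆C : W ⊆ vertexSet C
      W⊆C {u} u∈W with u ∈? vertexSet C
      ... | yes u∈C = u∈C
      ... | no u∉C
        with v , m , _ ← PerfectMatching.covers pm-W (x∈p∩q⁺ (u∈W , x∉p⇒x∈∁p u∉C))
        with _ , v∈ , u~v ← PerfectMatching.M-edges pm-W m
        = Edge⇒∈ G C (edgesC u∈W (proj₁ (x∈p∩q⁻ W (∁ (vertexSet C)) v∈)) u~v)

theorem5p2 : ∀ (n : ℕ) (G : OrientedGraph n) → 2 ∣ n → Connected G → Unicyclic G → (C : Cycle G) →
    Nonsingular (skewAdjacency G) ⇔
    ((𝒰₁ G (length C) × PerfectMatching G ⊤) ⊎
    (𝒰₂ G (length C) × OddlyOriented C × PerfectMatching G (∁ (vertexSet C))))
theorem5p2 n G _ _ unicyclic@(C₀ , C₀-unique) C = mk⇔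
  (λ nonsingular → nonsingular⇒matchings G C C-unique nonsingular unicyclic)
  λ { (inj₁ (u₁ , pm))       → 𝒰₁-matching⇒nonsingular G C C-unique u₁ pm
    ; (inj₂ (u₂ , odd , pm)) → 𝒰₂-matching⇒nonsingular G C C-unique u₂ odd pm }
  where
  C-unique : ∀ D → SameCycle G C D
  C-unique D = sameCycle-euclidean G C₀ C D (C₀-unique C) (C₀-unique D)
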